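{- Let $\varepsilon>0$ be given. Let $j,k$ be integers with $0<j\le k$ and $\gcd(j,k)=1$. Let $m$ be an integer with $m\ge 2/(k\varepsilon)+1$ such that $mj\equiv 1 \pmod{k}$. Let $l$ be a positive integer, put $n=k(m^2+1)$ and $t=2m+ln-j(m^2+1)$. Then \[ S(mt+1,nt)=l-3-\frac{j}{k}+E \] for some real number $E$ with $0<E<\varepsilon$.
   Context: For a real number $x$, the sawtooth function is $((x))=x-\lfloor x\rfloor-1/2$ if $x\notin\mathbb{Z}$ and $((x))=0$ if $x\in\mathbb{Z}$. For a positive integer $n$ and an integer $m$ with $\gcd(m,n)=1$, the Dedekind sum is $s(m,n)=\sum_{k=1}^{n}((k/n))((mk/n))$, and $S(m,n)=12\,s(m,n)$. -}

module Defs where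

open import Data.Nat as ℕ using (ℕ; zero; suc)
open import Data.Integer as ℤ using (ℤ; +_)
open import Data.Rational as ℚ using (ℚ; _+_; _*_; _-_; 0ℚ; _/_; floor; >-nonZero)
open import Relation.Binary.PropositionalEquality using (_≡_)
open import Relation.Nullary using (yes; no)
open import Data.Rational.Properties using (_≟_)

toℚ : ℤ → ℚ
toℚ a = a / 1

-- a / n as a rational; the value for n = 0 is irrelevant (it is only used with n ≥ 1)
divℕ : ℤ → ℕ → ℚ
divℕ a zero = 0ℚ
divℕ a (suc n) = a / suc n

saw : ℚ → ℚ
saw x with x ≟ toℚ (floor x)
... | yes _ = 0ℚ
... | no _ = x - toℚ (floor x) - ½
  where
  ½ : ℚ
  ½ = + 1 / 2

sumFrom1 : ℕ → (ℕ → ℚ) → ℚ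
sumFrom1 zero f = 0ℚ
sumFrom1 (suc N) f = sumFrom1 N f + f (suc N)

dedekind : ℤ → ℕ → ℚ
dedekind m n = sumFrom1 n (λ k → saw (divℕ (+ k) n) * saw (divℕ (m ℤ.* + k) n))

S : ℤ → ℕ → ℚ
S m n = toℚ (+ 12) * dedekind m n

divPos : (p q : ℚ) → ℚ.0ℚ ℚ.< q → ℚ
divPos p q q>0 = ℚ._÷_ p q {{>-nonZero q>0}}

{-# OPTIONS --safe #-}

-- Dedekind's reciprocity law (proved by counting lattice points) yields, by the Euclidean
-- algorithm, the three-term relation: if q = ad − bc > 0 and (a , b) ≡ r (c , d) modulo q, then
--   S(a , b) = S(c , d) − S(r , q) + b/(dq) + d/(bq) + q/(bd) − 3.
-- For (a , b) = (mt + 1 , nt) and (c , d) = (m , n) one has q = n, and mj ≡ 1 (mod k) gives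
-- mt + 1 ≡ m² (mod n), so r = m. The two Dedekind sums cancel and E = 2m/n + 2/(nt).
module Submission where

open import Defs
open import Data.Nat as ℕ using (ℕ; zero; suc; NonZero)
import Data.Nat.Divisibility as ℕ
import Data.Nat.DivMod as ℕ
import Data.Nat.Properties as ℕ
open import Data.Nat.Coprimality using (Coprime)
open import Data.Nat.Induction using (<-rec)
open import Data.Fin using (Fin; toℕ; fromℕ<)
import Data.Fin.Properties as Fin
open import Data.Fin.Permutation using (Permutation; permutation)
open import Data.Integer as ℤ using (ℤ; +_; -[1+_])
import Data.Integer.Properties as ℤ
import Data.Integer.DivMod as ℤ
open import Data.Integer.Divisibility using (_∣_)
import Data.Integer.Divisibility.Signed as Signed
import Data.Integer.Tactic.RingSolver as ℤ-Solver
open import Data.Rational as ℚ using (ℚ; 0ℚ; 1ℚ; ½; floor; toℚᵘ)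
import Data.Rational.Properties as ℚ
open import Data.Rational.Unnormalised as ℚᵘ using (mkℚᵘ; *≡*)
import Data.Rational.Unnormalised.Properties as ℚᵘ
open import Data.Bool using (true; false; if_then_else_)
open import Data.Empty using (⊥-elim)
open import Data.Product using (∃; ∃₂; _×_; _,_)
open import Function using (_∘_)
open import Level using (0ℓ)
open import Relation.Binary.Definitions using (tri<; tri≈; tri>)
open import Relation.Binary.PropositionalEquality hiding (J)
open import Relation.Nullary using (yes; no; contradiction)
open import Relation.Nullary.Decidable using (dec⇒maybe)
import Tactic.RingSolver.Core.AlmostCommutativeRing as ACR

-- Multiplied by 12 a² b², reciprocity becomes an identity between integers: `4 b² s(a , b)` is the
-- integer sum `V`, so floors and residues are treated in ℤ, and the rational `S` is reached through
-- `S≡V`. Coprimality is carried as a Bézout identity: its coefficients supply the inverse that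
-- permutes the residues, and stability under shifts, negation and products reduces to polynomial
-- identities. A goal that holds only modulo known equations is written as an exact ring identity
-- containing explicit multiples of left side minus right side, which are then dropped one by one.
-- The numbers fit for these reasons. Modulo `n = k (m² + 1)`, the difference `mt + 1 - m²` is
-- `(m² + 1) (1 - mj)`, a multiple of `n` because `k` divides `mj - 1`. The term `t / n` of the
-- relation is `l - j / k + 2m / n`. Finally `E = 2 (mt + 1) / (nt)` satisfies `E (m - 1) < 2 / k`,
-- and the lower bound on `m` says exactly `2 / k ≤ (m - 1) ε`.

module IntegerReciprocity where

  open import Data.Integer using (_+_; _*_; _-_; -_; 0ℤ; 1ℤ; ∣_∣; _%ℕ_; _/ℕ_)
  open import Data.Integer.Tactic.RingSolver using (solve-∀)
  open import Algebra.Properties.Semiring.Sum ℤ.+-*-semiring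
    using (sum; sum-cong-≗; sum-permute; ∑-comm; ∑-distrib-+; *-distribˡ-sum)

  -- Finite sums of integers, power sums, indicators.

  ⅀ : ℕ → (ℕ → ℤ) → ℤ
  ⅀ n f = sum {n} (f ∘ toℕ)

  ⅀-cong : ∀ n {f g : ℕ → ℤ} → (∀ k → k ℕ.< n → f k ≡ g k) → ⅀ n f ≡ ⅀ n g
  ⅀-cong n f≡g = sum-cong-≗ (λ i → f≡g (toℕ i) (Fin.toℕ<n i))

  ⅀-distrib-+ : ∀ n (f g : ℕ → ℤ) → ⅀ n (λ k → f k + g k) ≡ ⅀ n f + ⅀ n g
  ⅀-distrib-+ n f g = ∑-distrib-+ {n} (f ∘ toℕ) (g ∘ toℕ)

  *-distribˡ-⅀ : ∀ n x (f : ℕ → ℤ) → x * ⅀ n f ≡ ⅀ n (λ k → x * f k)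
  *-distribˡ-⅀ n x f = *-distribˡ-sum {n} x (f ∘ toℕ)

  -- A single three-term rule serves every expansion below; shorter ones are padded with the summand
  -- `0ℤ * 0ℤ`.
  ⅀-linear : ∀ n (x y z : ℤ) (f g h : ℕ → ℤ) →
    ⅀ n (λ k → x * f k + y * g k + z * h k) ≡ x * ⅀ n f + y * ⅀ n g + z * ⅀ n h
  ⅀-linear n x y z f g h = begin
    ⅀ n (λ k → x * f k + y * g k + z * h k)
      ≡⟨ ⅀-distrib-+ n (λ k → x * f k + y * g k) (λ k → z * h k) ⟩
    ⅀ n (λ k → x * f k + y * g k) + ⅀ n (λ k → z * h k)
      ≡⟨ cong (_+ ⅀ n (λ k → z * h k)) (⅀-distrib-+ n (λ k → x * f k) (λ k → y * g k)) ⟩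
    ⅀ n (λ k → x * f k) + ⅀ n (λ k → y * g k) + ⅀ n (λ k → z * h k)
      ≡⟨ cong₂ _+_ (cong₂ _+_ (*-distribˡ-⅀ n x f) (*-distribˡ-⅀ n y g)) (*-distribˡ-⅀ n z h) ⟨
    x * ⅀ n f + y * ⅀ n g + z * ⅀ n h ∎
    where open ≡-Reasoning

  ⅀-comm : ∀ m n (f : ℕ → ℕ → ℤ) → ⅀ m (λ i → ⅀ n (f i)) ≡ ⅀ n (λ j → ⅀ m (λ i → f i j))
  ⅀-comm m n f = ∑-comm {m} {n} (λ i j → f (toℕ i) (toℕ j))

  ⅀-last : ∀ n f → ⅀ (suc n) f ≡ ⅀ n f + f n
  ⅀-last zero f = ℤ.+-comm (f 0) 0ℤ
  ⅀-last (suc n) f = trans (cong (λ x → f 0 + x) (⅀-last n (f ∘ suc))) (sym (ℤ.+-assoc (f 0) _ _))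

  ⅀-const : ∀ n x → ⅀ n (λ _ → x) ≡ + n * x
  ⅀-const zero x = refl
  ⅀-const (suc n) x = trans (cong (λ z → x + z) (⅀-const n x)) (sym (ℤ.suc-* (+ n) x))

  ⅀-id : ∀ n → + 2 * ⅀ n (λ k → + k) ≡ + n * (+ n - + 1)
  ⅀-id zero = refl
  ⅀-id (suc n) = begin
    + 2 * ⅀ (suc n) (λ k → + k)       ≡⟨ cong (+ 2 *_) (⅀-last n (λ k → + k)) ⟩
    + 2 * (⅀ n (λ k → + k) + + n)     ≡⟨ ℤ.*-distribˡ-+ (+ 2) (⅀ n (λ k → + k)) (+ n) ⟩
    + 2 * ⅀ n (λ k → + k) + + 2 * + n ≡⟨ cong (_+ + 2 * + n) (⅀-id n) ⟩
    + n * (+ n - + 1) + + 2 * + n     ≡⟨ step (+ n) ⟩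
    + suc n * (+ suc n - + 1)         ∎
    where
    open ≡-Reasoning
    step : ∀ x → x * (x - + 1) + + 2 * x ≡ (+ 1 + x) * (+ 1 + x - + 1)
    step = solve-∀

  ⅀-square : ∀ n → + 6 * ⅀ n (λ k → + k * + k) ≡ (+ n - + 1) * + n * (+ 2 * + n - + 1)
  ⅀-square zero = refl
  ⅀-square (suc n) = begin
    + 6 * ⅀ (suc n) sq             ≡⟨ cong (+ 6 *_) (⅀-last n sq) ⟩
    + 6 * (⅀ n sq + sq n)          ≡⟨ ℤ.*-distribˡ-+ (+ 6) (⅀ n sq) (sq n) ⟩
    + 6 * ⅀ n sq + + 6 * sq n      ≡⟨ cong (_+ + 6 * sq n) (⅀-square n) ⟩
    (+ n - + 1) * + n * (+ 2 * + n - + 1) + + 6 * sq n ≡⟨ step (+ n) ⟩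
    (+ suc n - + 1) * + suc n * (+ 2 * + suc n - + 1) ∎
    where
    open ≡-Reasoning
    sq : ℕ → ℤ
    sq k = + k * + k
    step : ∀ x → (x - + 1) * x * (+ 2 * x - + 1) + + 6 * (x * x)
      ≡ (+ 1 + x - + 1) * (+ 1 + x) * (+ 2 * (+ 1 + x) - + 1)
    step = solve-∀

  -- With the Boolean test, `χ (suc k) (suc g)` reduces to `χ k g`, and the induction in `⅀-χ`
  -- relies on this.
  χ : ℕ → ℕ → ℤ
  χ k g = if k ℕ.<ᵇ g then 1ℤ else 0ℤ

  χ-yes : ∀ {k g} → k ℕ.< g → χ k g ≡ 1ℤ
  χ-yes {k} {g} k<g with k ℕ.<ᵇ g | ℕ.<⇒<ᵇ k<g
  ... | true | _ = refl

  χ-no : ∀ {k g} → g ℕ.≤ k → χ k g ≡ 0ℤ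
  χ-no {k} {g} g≤k with k ℕ.<ᵇ g | ℕ.<ᵇ⇒< k g
  ... | true  | k<g = ⊥-elim (ℕ.<⇒≱ (k<g _) g≤k)
  ... | false | _   = refl

  ⅀-χ : ∀ n {g} (w : ℕ → ℤ) → g ℕ.≤ n → ⅀ n (λ k → w k * χ k g) ≡ ⅀ g w
  ⅀-χ n {zero} w _ = trans (⅀-cong n (λ k _ → ℤ.*-zeroʳ (w k))) (trans (⅀-const n 0ℤ) (ℤ.*-zeroʳ (+ n)))
  ⅀-χ (suc n) {suc g} w (ℕ.s≤s g≤n) = cong₂ _+_ (ℤ.*-identityʳ (w 0)) (⅀-χ n (w ∘ suc) g≤n)

  -- Bézout identities and multiplication on residues.

  Bézout : ℤ → ℤ → Set
  Bézout a b = ∃₂ λ x y → a * x + b * y ≡ 1ℤ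

  -- Two remainders differ by a multiple of `b` of absolute value below `b`, hence by zero.
  %ℕ-unique : ∀ z b .{{_ : NonZero b}} r q → r ℕ.< b → z ≡ + r + q * + b → z %ℕ b ≡ r
  %ℕ-unique z b r q r<b z≡ =
    ℤ.+-injective (ℤ.i-j≡0⇒i≡j (+ r') (+ r) (ℤ.∣i∣≡0⇒i≡0 (small dist<b b∣dist)))
    where
    r' = z %ℕ b
    q' = z /ℕ b
    eq : + r' - + r ≡ (q - q') * + b
    eq = begin
      + r' - + r                            ≡⟨ lem (+ r') (+ r) (q' * + b) ⟩
      + r' + q' * + b - + r - q' * + b      ≡⟨ cong (λ w → w - + r - q' * + b) (trans (sym (ℤ.a≡a%ℕn+[a/ℕn]*n z b)) z≡) ⟩
      + r + q * + b - + r - q' * + b        ≡⟨ lem' (+ r) q q' (+ b) ⟩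
      (q - q') * + b                        ∎
      where
      open ≡-Reasoning
      lem : ∀ x y z → x - y ≡ x + z - y - z
      lem = solve-∀
      lem' : ∀ x y z w → x + y * w - x - z * w ≡ (y - z) * w
      lem' = solve-∀
    b∣dist : b ℕ.∣ ∣ + r' - + r ∣
    b∣dist = ℕ.divides ∣ q - q' ∣ (trans (cong ∣_∣ eq) (ℤ.abs-* (q - q') (+ b)))
    dist<b : ∣ + r' - + r ∣ ℕ.< b
    dist<b = ℕ.≤-<-trans
      (ℕ.≤-trans (ℕ.≤-reflexive (cong ∣_∣ (ℤ.m-n≡m⊖n r' r))) (ℤ.∣m⊝n∣≤m⊔n r' r))
      (ℕ.⊔-pres-<m (ℤ.n%ℕd<d z b) r<b)
    small : ∀ {d} → d ℕ.< b → b ℕ.∣ d → d ≡ 0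
    small {zero} _ _ = refl
    small {suc d} d<b b∣d = ⊥-elim (ℕ.<⇒≱ d<b (ℕ.∣⇒≤ b∣d))

  %ℕ-≡ : ∀ x y b .{{_ : NonZero b}} q → x ≡ y + q * + b → x %ℕ b ≡ y %ℕ b
  %ℕ-≡ x y b q x≡ = %ℕ-unique x b (y %ℕ b) (y /ℕ b + q) (ℤ.n%ℕd<d y b) (begin
    x ≡⟨ x≡ ⟩
    y + q * + b ≡⟨ cong (_+ q * + b) (ℤ.a≡a%ℕn+[a/ℕn]*n y b) ⟩
    + (y %ℕ b) + y /ℕ b * + b + q * + b ≡⟨ lem (+ (y %ℕ b)) (y /ℕ b) q (+ b) ⟩
    + (y %ℕ b) + (y /ℕ b + q) * + b ∎)
    where
    open ≡-Reasoning
    lem : ∀ r u q b → r + u * b + q * b ≡ r + (u + q) * b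
    lem = solve-∀

  -- Modulo `b` the coefficient `x` is the inverse of `a`, so multiplying by `x` undoes multiplying
  -- by `a`, even after reduction.
  Bézout⇒inverse : ∀ a x y b .{{_ : NonZero b}} → a * x + + b * y ≡ 1ℤ →
    ∀ k → k ℕ.< b → (x * + ((a * + k) %ℕ b)) %ℕ b ≡ k
  Bézout⇒inverse a x y b ax+by≡1 k k<b =
    %ℕ-unique _ b k (- y * + k - x * q) k<b (begin
      x * + r                                          ≡⟨ lem x (+ r) q (+ b) ⟩
      x * (+ r + q * + b) - x * q * + b                ≡⟨ cong (λ z → x * z - x * q * + b) (ℤ.a≡a%ℕn+[a/ℕn]*n (a * + k) b) ⟨
      x * (a * + k) - x * q * + b                      ≡⟨ lem' a x y (+ b) (+ k) q ⟩
      (a * x + + b * y) * + k + (- y * + k - x * q) * + b ≡⟨ cong (λ z → z * + k + (- y * + k - x * q) * + b) ax+by≡1 ⟩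
      1ℤ * + k + (- y * + k - x * q) * + b             ≡⟨ cong (_+ (- y * + k - x * q) * + b) (ℤ.*-identityˡ (+ k)) ⟩
      + k + (- y * + k - x * q) * + b                  ∎)
    where
    open ≡-Reasoning
    r = (a * + k) %ℕ b
    q = (a * + k) /ℕ b
    lem : ∀ x r q b → x * r ≡ x * (r + q * b) - x * q * b
    lem = solve-∀
    lem' : ∀ a x y b k q → x * (a * k) - x * q * b ≡ (a * x + b * y) * k + (- y * k - x * q) * b
    lem' = solve-∀

  -- Multiplication by a unit permutes the residues modulo `b`. The summand is kept general because
  -- both the sum and the sum of squares of the residues are needed.
  ⅀-permute-unit : ∀ a b .{{_ : NonZero b}} → Bézout a (+ b) →
    ∀ (f : ℕ → ℤ) → ⅀ b (λ k → f ((a * + k) %ℕ b)) ≡ ⅀ b f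
  ⅀-permute-unit a b (x , y , ax+by≡1) f =
    trans (sum-cong-≗ {b} (λ i → cong f (sym (toℕ-mul a i)))) (sym (sum-permute {b} (f ∘ toℕ) π))
    where
    mul : ℤ → Fin b → Fin b
    mul c i = fromℕ< (ℤ.n%ℕd<d (c * + toℕ i) b)
    toℕ-mul : ∀ c i → toℕ (mul c i) ≡ (c * + toℕ i) %ℕ b
    toℕ-mul c i = Fin.toℕ-fromℕ< (ℤ.n%ℕd<d (c * + toℕ i) b)
    inverse : ∀ c d e → c * d + + b * e ≡ 1ℤ → ∀ i → mul d (mul c i) ≡ i
    inverse c d e cd+be≡1 i = Fin.toℕ-injective (begin
      toℕ (mul d (mul c i))               ≡⟨ toℕ-mul d (mul c i) ⟩
      (d * + toℕ (mul c i)) %ℕ b          ≡⟨ cong (λ z → (d * + z) %ℕ b) (toℕ-mul c i) ⟩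
      (d * + ((c * + toℕ i) %ℕ b)) %ℕ b   ≡⟨ Bézout⇒inverse c d e b cd+be≡1 (toℕ i) (Fin.toℕ<n i) ⟩
      toℕ i                               ∎)
      where open ≡-Reasoning
    π : Permutation b b
    π = permutation (mul a) (mul x)
      (inverse x a y (trans (cong (_+ + b * y) (ℤ.*-comm x a)) ax+by≡1))
      (inverse a x y ax+by≡1)

  Bézout-comm : ∀ {a b} → Bézout a b → Bézout b a
  Bézout-comm {a} {b} (x , y , eq) = y , x , trans (ℤ.+-comm (b * y) (a * x)) eq

  -- If `b i = a k`, then `i = i (a x + b y) = a (i x + k y)`, so `a` divides `i`, which is
  -- impossible for `0 < i < a`: no lattice point lies on the diagonal.
  Bézout⇒*≢* : ∀ {a b i k} → Bézout (+ a) (+ b) → 0 ℕ.< i → i ℕ.< a → b ℕ.* i ≢ a ℕ.* k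
  Bézout⇒*≢* {a} {b} {i} {k} (x , y , eq) 0<i i<a bi≡ak =
    ℕ.<⇒≱ i<a (ℕ.∣⇒≤ {{ℕ.>-nonZero 0<i}} (ℕ.divides ∣ + i * x + + k * y ∣ i≡))
    where
    open ≡-Reasoning
    lem : ∀ a b i x y → i * (a * x + b * y) ≡ i * x * a + b * i * y
    lem = solve-∀
    lem' : ∀ a i k x y → i * x * a + a * k * y ≡ (i * x + k * y) * a
    lem' = solve-∀
    i≡ : i ≡ ∣ + i * x + + k * y ∣ ℕ.* a
    i≡ = begin
      ∣ + i ∣                              ≡⟨ cong ∣_∣ (ℤ.*-identityʳ (+ i)) ⟨
      ∣ + i * 1ℤ ∣                         ≡⟨ cong (λ z → ∣ + i * z ∣) eq ⟨
      ∣ + i * (+ a * x + + b * y) ∣        ≡⟨ cong ∣_∣ (lem (+ a) (+ b) (+ i) x y) ⟩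
      ∣ + i * x * + a + + b * + i * y ∣    ≡⟨ cong (λ z → ∣ + i * x * + a + z * y ∣) (trans (sym (ℤ.pos-* b i)) (trans (cong +_ bi≡ak) (ℤ.pos-* a k))) ⟩
      ∣ + i * x * + a + + a * + k * y ∣    ≡⟨ cong ∣_∣ (lem' (+ a) (+ i) (+ k) x y) ⟩
      ∣ (+ i * x + + k * y) * + a ∣        ≡⟨ ℤ.abs-* (+ i * x + + k * y) (+ a) ⟩
      ∣ + i * x + + k * y ∣ ℕ.* a          ∎

  -- Counting lattice points below the diagonal of a rectangle.

  m*o≤n⇒m≤n/o : ∀ m {n} o .{{_ : NonZero o}} → m ℕ.* o ℕ.≤ n → m ℕ.≤ n ℕ./ o
  m*o≤n⇒m≤n/o m o mo≤n = subst (ℕ._≤ _) (ℕ.m*n/n≡m m o) (ℕ./-monoˡ-≤ o mo≤n)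

  -- i ≤ ⌊ak/b⌋ and k ≤ ⌊bi/a⌋ say bi ≤ ak and ak ≤ bi; equality is excluded by coprimality.
  χ-dual : ∀ a b .{{_ : NonZero a}} .{{_ : NonZero b}} → Bézout (+ a) (+ b) →
    ∀ i k → i ℕ.< a →
    + i * χ i (suc (a ℕ.* k ℕ./ b)) ≡ + i * (1ℤ - χ k (suc (b ℕ.* i ℕ./ a)))
  -- At `i = 0` the origin lies on the diagonal and the two indicators are not complementary; the
  -- weight `i` removes this row.
  χ-dual a b bez zero k _ = refl
  χ-dual a b bez i@(suc _) k i<a with ℕ.<-cmp (b ℕ.* i) (a ℕ.* k)
  ... | tri< bi<ak _ _ = cong (λ z → + i * z) (trans
    (χ-yes {i} (ℕ.s≤s (m*o≤n⇒m≤n/o i b (subst (ℕ._≤ a ℕ.* k) (ℕ.*-comm b i) (ℕ.<⇒≤ bi<ak)))))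
    (sym (cong (λ z → 1ℤ - z) (χ-no {k} (ℕ.m<n*o⇒m/o<n (subst (b ℕ.* i ℕ.<_) (ℕ.*-comm a k) bi<ak))))))
  ... | tri> _ _ bi>ak = cong (λ z → + i * z) (trans
    (χ-no {i} (ℕ.m<n*o⇒m/o<n (subst (a ℕ.* k ℕ.<_) (ℕ.*-comm b i) bi>ak)))
    (sym (cong (λ z → 1ℤ - z) (χ-yes {k} (ℕ.s≤s (m*o≤n⇒m≤n/o k a (subst (ℕ._≤ b ℕ.* i) (ℕ.*-comm a k) (ℕ.<⇒≤ bi>ak))))))))
  ... | tri≈ _ bi≡ak _ = ⊥-elim (Bézout⇒*≢* {a} {b} {i} {k} bez (ℕ.s≤s ℕ.z≤n) i<a bi≡ak)

  -- Both sides are 2 Σ i over the pairs (i , k) with 0 < i < a, 0 < k < b and bi < ak.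
  ⅀-floor : ∀ a b .{{_ : NonZero a}} .{{_ : NonZero b}} → Bézout (+ a) (+ b) →
    let f = λ k → + (a ℕ.* k ℕ./ b)
        g = λ i → + (b ℕ.* i ℕ./ a)
    in ⅀ b (λ k → f k * f k) + ⅀ b f
       ≡ + 2 * ((+ b - + 1) * ⅀ a (λ i → + i) - ⅀ a (λ i → + i * g i))
  ⅀-floor a b bez = begin
    ⅀ b (λ k → f k * f k) + ⅀ b f
      ≡⟨ ⅀-distrib-+ b (λ k → f k * f k) f ⟨
    ⅀ b (λ k → f k * f k + f k)
      -- `f² + f` is twice the sum of `0 , … , f`. Since `F k < a`, this sum extends to all `i < a`
      -- with an indicator, and the order of summation can be exchanged.
      ≡⟨ ⅀-cong b (λ k k<b → trans (triangle (f k)) (trans (sym (⅀-id (suc (F k))))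
           (cong (λ z → + 2 * z) (sym (⅀-χ a (λ i → + i) (F<a k k<b)))))) ⟩
    ⅀ b (λ k → + 2 * ⅀ a (λ i → + i * χ i (suc (F k))))
      ≡⟨ *-distribˡ-⅀ b (+ 2) (λ k → ⅀ a (λ i → + i * χ i (suc (F k)))) ⟨
    + 2 * ⅀ b (λ k → ⅀ a (λ i → + i * χ i (suc (F k))))
      ≡⟨ cong (λ z → + 2 * z) (⅀-comm b a (λ k i → + i * χ i (suc (F k)))) ⟩
    + 2 * ⅀ a (λ i → ⅀ b (λ k → + i * χ i (suc (F k))))
      ≡⟨ cong (λ z → + 2 * z) (⅀-cong a column) ⟩
    + 2 * ⅀ a (λ i → (+ b - + 1) * + i + - + 1 * (+ i * g i) + 0ℤ * 0ℤ)
      ≡⟨ cong (λ z → + 2 * z) (⅀-linear a (+ b - + 1) (- + 1) 0ℤ (λ i → + i) (λ i → + i * g i) (λ _ → 0ℤ)) ⟩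
    + 2 * ((+ b - + 1) * ⅀ a (λ i → + i) + - + 1 * ⅀ a (λ i → + i * g i) + 0ℤ * ⅀ a (λ _ → 0ℤ))
      ≡⟨ tidy (+ b - + 1) (⅀ a (λ i → + i)) (⅀ a (λ i → + i * g i)) (⅀ a (λ _ → 0ℤ)) ⟩
    + 2 * ((+ b - + 1) * ⅀ a (λ i → + i) - ⅀ a (λ i → + i * g i)) ∎
    where
    open ≡-Reasoning
    F G : ℕ → ℕ
    F k = a ℕ.* k ℕ./ b
    G i = b ℕ.* i ℕ./ a
    f g : ℕ → ℤ
    f k = + F k
    g i = + G i
    F<a : ∀ k → k ℕ.< b → F k ℕ.< a
    F<a k k<b = ℕ.m<n*o⇒m/o<n (ℕ.*-monoʳ-< a k<b)
    G<b : ∀ i → i ℕ.< a → G i ℕ.< b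
    G<b i i<a = ℕ.m<n*o⇒m/o<n (ℕ.*-monoʳ-< b i<a)
    triangle : ∀ x → x * x + x ≡ (+ 1 + x) * (+ 1 + x - + 1)
    triangle = solve-∀
    tidy : ∀ b p s z → + 2 * (b * p + - + 1 * s + 0ℤ * z) ≡ + 2 * (b * p - s)
    tidy = solve-∀
    expand : ∀ i c → i * (1ℤ - c) ≡ i * 1ℤ + - i * (1ℤ * c) + 0ℤ * 0ℤ
    expand = solve-∀
    collect : ∀ i b g z → i * (b * 1ℤ) + - i * ((1ℤ + g) * 1ℤ) + 0ℤ * z ≡ (b - + 1) * i + - + 1 * (i * g) + 0ℤ * 0ℤ
    collect = solve-∀
    column : ∀ i → i ℕ.< a → ⅀ b (λ k → + i * χ i (suc (F k))) ≡ (+ b - + 1) * + i + - + 1 * (+ i * g i) + 0ℤ * 0ℤ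
    column i i<a = begin
      ⅀ b (λ k → + i * χ i (suc (F k)))
        ≡⟨ ⅀-cong b (λ k _ → trans (χ-dual a b bez i k i<a) (expand (+ i) (χ k (suc (G i))))) ⟩
      ⅀ b (λ k → + i * 1ℤ + - + i * (1ℤ * χ k (suc (G i))) + 0ℤ * 0ℤ)
        ≡⟨ ⅀-linear b (+ i) (- + i) 0ℤ (λ _ → 1ℤ) (λ k → 1ℤ * χ k (suc (G i))) (λ _ → 0ℤ) ⟩
      + i * ⅀ b (λ _ → 1ℤ) + - + i * ⅀ b (λ k → 1ℤ * χ k (suc (G i))) + 0ℤ * ⅀ b (λ _ → 0ℤ)
        ≡⟨ cong₂ (λ u v → + i * u + - + i * v + 0ℤ * ⅀ b (λ _ → 0ℤ))
             (⅀-const b 1ℤ) (trans (⅀-χ b (λ _ → 1ℤ) (G<b i i<a)) (⅀-const (suc (G i)) 1ℤ)) ⟩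
      + i * (+ b * 1ℤ) + - + i * ((1ℤ + g i) * 1ℤ) + 0ℤ * ⅀ b (λ _ → 0ℤ)
        ≡⟨ collect (+ i) (+ b) (g i) (⅀ b (λ _ → 0ℤ)) ⟩
      (+ b - + 1) * + i + - + 1 * (+ i * g i) + 0ℤ * 0ℤ ∎

  -- The integer Dedekind sum and its moment.

  module _ (a : ℤ) (b : ℕ) .{{_ : NonZero b}} where

    residue : ℕ → ℤ
    residue k = + ((a * + k) %ℕ b)

    -- For `0 < k < b`, `2 k - b` is `2 b` times the sawtooth of `k / b`. At `k = 0` the term would
    -- be `b * b` while the sawtooth product is zero, so `V` starts at 1.
    V-term : ℕ → ℤ
    V-term k = (+ 2 * + k - + b) * (+ 2 * residue k - + b)

    -- 4 b² s(a , b), for a prime to b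
    V : ℤ
    V = ⅀ (ℕ.pred b) (V-term ∘ suc)

    moment : ℤ
    moment = ⅀ b (λ k → + k * residue k)

  -- This brings a hypothesis `x ≡ y` into ring solving: the solver proves the goal up to a multiple
  -- of `x - y`, which is removed here.
  +-drop-zero : ∀ c {x y} → x ≡ y → ∀ z → z + c * (x - y) ≡ z
  +-drop-zero c {x} {y} x≡y z = trans (cong (λ w → z + c * w) (ℤ.i≡j⇒i-j≡0 x≡y))
    (trans (cong (λ w → z + w) (ℤ.*-zeroʳ c)) (ℤ.+-identityʳ z))

  ⅀-residue : ∀ a b .{{_ : NonZero b}} → Bézout a (+ b) → ⅀ b (residue a b) ≡ ⅀ b (λ k → + k)
  ⅀-residue a b bez = ⅀-permute-unit a b bez (λ k → + k)

  -- Besides `moment`, expanding the product leaves the sum of the residues, which is the sum of all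
  -- `k < b` because the residues are permuted.
  V≡moment : ∀ a b .{{_ : NonZero b}} → Bézout a (+ b) →
    V a b ≡ + 4 * moment a b - + b * + b * (+ b - + 1)
  V≡moment a b@(suc b-1) bez = begin
    V a b
      -- Adding and subtracting the term at `k = 0` completes the sum to all residues, where the
      -- permutation acts.
      ≡⟨ peel (V a b) (+ b) ⟩
    (- + b) * (- + b) + V a b - + b * + b
      ≡⟨ cong (λ z → z - + b * + b) term₀ ⟨
    ⅀ b (V-term a b) - + b * + b
      ≡⟨ cong (λ z → z - + b * + b) (⅀-cong b (λ k _ → expand (+ k) (r k) (+ b))) ⟩
    ⅀ b (λ k → + 4 * (+ k * r k) + - (+ 2 * + b) * (+ k + r k) + + b * + b * 1ℤ) - + b * + b
      ≡⟨ cong (λ z → z - + b * + b) (⅀-linear b (+ 4) (- (+ 2 * + b)) (+ b * + b) (λ k → + k * r k) (λ k → + k + r k) (λ _ → 1ℤ)) ⟩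
    + 4 * moment a b + - (+ 2 * + b) * ⅀ b (λ k → + k + r k) + + b * + b * ⅀ b (λ _ → 1ℤ) - + b * + b
      ≡⟨ cong₂ (λ u v → + 4 * moment a b + - (+ 2 * + b) * u + + b * + b * v - + b * + b)
           (trans (⅀-distrib-+ b (λ k → + k) r) (cong (λ z → P + z) (⅀-residue a b bez))) (⅀-const b 1ℤ) ⟩
    + 4 * moment a b + - (+ 2 * + b) * (P + P) + + b * + b * (+ b * 1ℤ) - + b * + b
      ≡⟨ tidy (moment a b) (+ b) P ⟩
    + 4 * moment a b - + b * + b * (+ b - + 1) + - (+ 2 * + b) * (+ 2 * P - + b * (+ b - + 1))
      ≡⟨ +-drop-zero (- (+ 2 * + b)) (⅀-id b) (+ 4 * moment a b - + b * + b * (+ b - + 1)) ⟩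
    + 4 * moment a b - + b * + b * (+ b - + 1) ∎
    where
    open ≡-Reasoning
    r : ℕ → ℤ
    r = residue a b
    P : ℤ
    P = ⅀ b (λ k → + k)
    peel : ∀ v b → v ≡ - b * - b + v - b * b
    peel = solve-∀
    expand : ∀ k r b → (+ 2 * k - b) * (+ 2 * r - b) ≡ + 4 * (k * r) + - (+ 2 * b) * (k + r) + b * b * 1ℤ
    expand = solve-∀
    tidy : ∀ d b p → + 4 * d + - (+ 2 * b) * (p + p) + b * b * (b * 1ℤ) - b * b
      ≡ + 4 * d - b * b * (b - + 1) + - (+ 2 * b) * (+ 2 * p - b * (b - + 1))
    tidy = solve-∀
    r₀ : (a * + 0) %ℕ b ≡ 0
    r₀ = cong (_%ℕ b) (ℤ.*-zeroʳ a)
    neg : ∀ x → (+ 2 * + 0 - x) * (+ 2 * + 0 - x) ≡ - x * - x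
    neg = solve-∀
    term₀ : ⅀ b (V-term a b) ≡ (- + b) * (- + b) + V a b
    term₀ = cong (λ z → z + V a b) (trans (cong (λ z → (+ 2 * + 0 - + b) * (+ 2 * + z - + b)) r₀) (neg (+ b)))

  module _ (a b : ℕ) .{{_ : NonZero b}} where

    private
      f r : ℕ → ℤ
      f k = + (a ℕ.* k ℕ./ b)
      r = residue (+ a) b

    a*k≡r+f*b : ∀ k → + a * + k ≡ r k + f k * + b
    a*k≡r+f*b k = trans (ℤ.a≡a%ℕn+[a/ℕn]*n (+ a * + k) b)
      (cong (λ z → r k + z /ℕ b * + b) (sym (ℤ.pos-* a k)))

    ⅀-floor¹ : Bézout (+ a) (+ b) → + b * ⅀ b f ≡ + a * ⅀ b (λ k → + k) - ⅀ b (λ k → + k)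
    ⅀-floor¹ bez = begin
      + b * ⅀ b f ≡⟨ *-distribˡ-⅀ b (+ b) f ⟩
      ⅀ b (λ k → + b * f k) ≡⟨ ⅀-cong b (λ k _ → trans (lem (+ b) (f k) (r k)) (cong (λ z → 1ℤ * z + - 1ℤ * r k + 0ℤ * 0ℤ) (sym (a*k≡r+f*b k)))) ⟩
      ⅀ b (λ k → 1ℤ * (+ a * + k) + - 1ℤ * r k + 0ℤ * 0ℤ)
        ≡⟨ ⅀-linear b 1ℤ (- 1ℤ) 0ℤ (λ k → + a * + k) r (λ _ → 0ℤ) ⟩
      1ℤ * ⅀ b (λ k → + a * + k) + - 1ℤ * ⅀ b r + 0ℤ * ⅀ b (λ _ → 0ℤ)
        ≡⟨ cong₂ (λ u v → 1ℤ * u + - 1ℤ * v + 0ℤ * ⅀ b (λ _ → 0ℤ)) (sym (*-distribˡ-⅀ b (+ a) (λ k → + k))) (⅀-residue (+ a) b bez) ⟩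
      1ℤ * (+ a * P) + - 1ℤ * P + 0ℤ * ⅀ b (λ _ → 0ℤ) ≡⟨ tidy (+ a * P) P (⅀ b (λ _ → 0ℤ)) ⟩
      + a * P - P ∎
      where
      open ≡-Reasoning
      P = ⅀ b (λ k → + k)
      lem : ∀ b f r → b * f ≡ 1ℤ * (r + f * b) + - 1ℤ * r + 0ℤ * 0ℤ
      lem = solve-∀
      tidy : ∀ x y z → 1ℤ * x + - 1ℤ * y + 0ℤ * z ≡ x - y
      tidy = solve-∀

    -- Square `b f = a k - r` and sum. The sum of `r²` equals that of `k²` by permutation, so the
    -- squared floors determine the cross term `k r`, that is, `moment`.
    ⅀-floor² : Bézout (+ a) (+ b) → let Q = ⅀ b (λ k → + k * + k) in
      + b * + b * ⅀ b (λ k → f k * f k) ≡ Q + + a * + a * Q - + 2 * + a * moment (+ a) b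
    ⅀-floor² bez = begin
      + b * + b * ⅀ b (λ k → f k * f k) ≡⟨ *-distribˡ-⅀ b (+ b * + b) (λ k → f k * f k) ⟩
      ⅀ b (λ k → + b * + b * (f k * f k)) ≡⟨ ⅀-cong b (λ k _ → pointwise k) ⟩
      ⅀ b (λ k → 1ℤ * (r k * r k) + + a * + a * (+ k * + k) + - (+ 2 * + a) * (+ k * r k))
        ≡⟨ ⅀-linear b 1ℤ (+ a * + a) (- (+ 2 * + a)) (λ k → r k * r k) (λ k → + k * + k) (λ k → + k * r k) ⟩
      1ℤ * ⅀ b (λ k → r k * r k) + + a * + a * Q + - (+ 2 * + a) * moment (+ a) b
        ≡⟨ cong (λ z → 1ℤ * z + + a * + a * Q + - (+ 2 * + a) * moment (+ a) b) (⅀-permute-unit (+ a) b bez (λ k → + k * + k)) ⟩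
      1ℤ * Q + + a * + a * Q + - (+ 2 * + a) * moment (+ a) b ≡⟨ tidy Q (+ a) (moment (+ a) b) ⟩
      Q + + a * + a * Q - + 2 * + a * moment (+ a) b ∎
      where
      open ≡-Reasoning
      Q = ⅀ b (λ k → + k * + k)
      tidy : ∀ q a d → 1ℤ * q + a * a * q + - (+ 2 * a) * d ≡ q + a * a * q - + 2 * a * d
      tidy = solve-∀
      lem : ∀ b f r → b * b * (f * f) ≡ 1ℤ * (r * r) + (r + f * b) * (r + f * b) + - (+ 2 * (r + f * b)) * r
      lem = solve-∀
      lem' : ∀ a k r → 1ℤ * (r * r) + a * k * (a * k) + - (+ 2 * (a * k)) * r ≡ 1ℤ * (r * r) + a * a * (k * k) + - (+ 2 * a) * (k * r)
      lem' = solve-∀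
      pointwise : ∀ k → + b * + b * (f k * f k) ≡ 1ℤ * (r k * r k) + + a * + a * (+ k * + k) + - (+ 2 * + a) * (+ k * r k)
      pointwise k = trans (lem (+ b) (f k) (r k))
        (trans (cong (λ z → 1ℤ * (r k * r k) + z * z + - (+ 2 * z) * r k) (sym (a*k≡r+f*b k))) (lem' (+ a) (+ k) (r k)))

    ⅀-*-floor : + b * ⅀ b (λ k → + k * f k) ≡ + a * ⅀ b (λ k → + k * + k) - moment (+ a) b
    ⅀-*-floor = begin
      + b * ⅀ b (λ k → + k * f k) ≡⟨ *-distribˡ-⅀ b (+ b) (λ k → + k * f k) ⟩
      ⅀ b (λ k → + b * (+ k * f k)) ≡⟨ ⅀-cong b (λ k _ → pointwise k) ⟩
      ⅀ b (λ k → + a * (+ k * + k) + - 1ℤ * (+ k * r k) + 0ℤ * 0ℤ)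
        ≡⟨ ⅀-linear b (+ a) (- 1ℤ) 0ℤ (λ k → + k * + k) (λ k → + k * r k) (λ _ → 0ℤ) ⟩
      + a * Q + - 1ℤ * moment (+ a) b + 0ℤ * ⅀ b (λ _ → 0ℤ) ≡⟨ tidy (+ a * Q) (moment (+ a) b) (⅀ b (λ _ → 0ℤ)) ⟩
      + a * Q - moment (+ a) b ∎
      where
      open ≡-Reasoning
      Q = ⅀ b (λ k → + k * + k)
      tidy : ∀ x y z → x + - 1ℤ * y + 0ℤ * z ≡ x - y
      tidy = solve-∀
      lem : ∀ b k f r → b * (k * f) ≡ k * (r + f * b) - k * r
      lem = solve-∀
      lem' : ∀ a k r → k * (a * k) - k * r ≡ a * (k * k) + - 1ℤ * (k * r) + 0ℤ * 0ℤ
      lem' = solve-∀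
      pointwise : ∀ k → + b * (+ k * f k) ≡ + a * (+ k * + k) + - 1ℤ * (+ k * r k) + 0ℤ * 0ℤ
      pointwise k = trans (lem (+ b) (+ k) (f k) (r k))
        (trans (cong (λ z → + k * z - + k * r k) (sym (a*k≡r+f*b k))) (lem' (+ a) (+ k) (r k)))

  -- Dedekind reciprocity multiplied by 12 a² b². Once the moments are in place, it is a polynomial
  -- combination of eight known relations.
  V-reciprocity : ∀ a b .{{_ : NonZero a}} .{{_ : NonZero b}} → Bézout (+ a) (+ b) →
    + 3 * (+ a * + a * V (+ a) b + + b * + b * V (+ b) a)
    ≡ + a * + b * (+ a * + a + + b * + b + + 1 - + 3 * (+ a * + b))
  V-reciprocity a b bez = begin
    + 3 * (+ a * + a * V (+ a) b + + b * + b * V (+ b) a)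
      ≡⟨ cong₂ (λ u v → + 3 * (+ a * + a * u + + b * + b * v)) (V≡moment (+ a) b bez) (V≡moment (+ b) a bez') ⟩
    + 3 * (A * A * (+ 4 * d - B * B * (B - + 1)) + B * B * (+ 4 * d' - A * A * (A - + 1)))
      -- The multipliers follow the eliminations: `⅀-floor²` trades `d` for `f₂`, the lattice count
      -- trades `f₂` for `f₁` and `g`, `⅀-floor¹` removes `f₁`, and `⅀-*-floor` trades `g` for `d'`.
      -- Only power sums are left, and the closed formulas remove these.
      ≡⟨ identity A B d d' p p' q q' f₁ f₂ g ⟩
    z₈
      ≡⟨ +-drop-zero (+ 2 * B * B * B) (⅀-square a) z₇ ⟩
    z₇
      ≡⟨ +-drop-zero (A * (+ 1 + A * A)) (⅀-square b) z₆ ⟩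
    z₆
      ≡⟨ +-drop-zero (- (+ 6 * A * B * B * (B - + 1))) (⅀-id a) z₅ ⟩
    z₅
      ≡⟨ +-drop-zero (+ 3 * A * B * (A - + 1)) (⅀-id b) z₄ ⟩
    z₄
      ≡⟨ +-drop-zero (- (+ 6 * A * B * B)) (⅀-floor a b bez) z₃ ⟩
    z₃
      ≡⟨ +-drop-zero (+ 12 * B * B) (⅀-*-floor b a) z₂ ⟩
    z₂
      ≡⟨ +-drop-zero (+ 6 * A) (⅀-floor² a b bez) z₁ ⟩
    z₁
      ≡⟨ +-drop-zero (+ 6 * A * B) (⅀-floor¹ a b bez) z₀ ⟩
    z₀ ∎
    where
    open ≡-Reasoning
    bez' = Bézout-comm {+ a} {+ b} bez
    A = + a
    B = + b
    d = moment (+ a) b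
    d' = moment (+ b) a
    p = ⅀ b (λ k → + k)
    p' = ⅀ a (λ k → + k)
    q = ⅀ b (λ k → + k * + k)
    q' = ⅀ a (λ k → + k * + k)
    f₁ = ⅀ b (λ k → + (a ℕ.* k ℕ./ b))
    f₂ = ⅀ b (λ k → + (a ℕ.* k ℕ./ b) * + (a ℕ.* k ℕ./ b))
    g = ⅀ a (λ i → + i * + (b ℕ.* i ℕ./ a))
    z₀ = A * B * (A * A + B * B + + 1 - + 3 * (A * B))
    z₁ = z₀ + + 6 * A * B * (B * f₁ - (A * p - p))
    z₂ = z₁ + + 6 * A * (B * B * f₂ - (q + A * A * q - + 2 * A * d))
    z₃ = z₂ + + 12 * B * B * (A * g - (B * q' - d'))
    z₄ = z₃ + - (+ 6 * A * B * B) * (f₂ + f₁ - + 2 * ((B - + 1) * p' - g))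
    z₅ = z₄ + + 3 * A * B * (A - + 1) * (+ 2 * p - B * (B - + 1))
    z₆ = z₅ + - (+ 6 * A * B * B * (B - + 1)) * (+ 2 * p' - A * (A - + 1))
    z₇ = z₆ + A * (+ 1 + A * A) * (+ 6 * q - (B - + 1) * B * (+ 2 * B - + 1))
    z₈ = z₇ + + 2 * B * B * B * (+ 6 * q' - (A - + 1) * A * (+ 2 * A - + 1))
    identity : ∀ A B d d' p p' q q' f₁ f₂ g →
      + 3 * (A * A * (+ 4 * d - B * B * (B - + 1)) + B * B * (+ 4 * d' - A * A * (A - + 1)))
      ≡ A * B * (A * A + B * B + + 1 - + 3 * (A * B))
        + + 6 * A * B * (B * f₁ - (A * p - p))
        + + 6 * A * (B * B * f₂ - (q + A * A * q - + 2 * A * d))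
        + + 12 * B * B * (A * g - (B * q' - d'))
        + - (+ 6 * A * B * B) * (f₂ + f₁ - + 2 * ((B - + 1) * p' - g))
        + + 3 * A * B * (A - + 1) * (+ 2 * p - B * (B - + 1))
        + - (+ 6 * A * B * B * (B - + 1)) * (+ 2 * p' - A * (A - + 1))
        + A * (+ 1 + A * A) * (+ 6 * q - (B - + 1) * B * (+ 2 * B - + 1))
        + + 2 * B * B * B * (+ 6 * q' - (A - + 1) * A * (+ 2 * A - + 1))
    identity = solve-∀

  -- Periodicity and oddness of `V`.

  V-periodic : ∀ a a' b .{{_ : NonZero b}} s → a ≡ a' + s * + b → V a b ≡ V a' b
  V-periodic a a' b s a≡ = ⅀-cong (ℕ.pred b) (λ k _ →
    cong (λ z → (+ 2 * + suc k - + b) * (+ 2 * + z - + b)) (residues≡ (suc k)))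
    where
    lem : ∀ a s b k → (a + s * b) * k ≡ a * k + s * k * b
    lem = solve-∀
    residues≡ : ∀ k → (a * + k) %ℕ b ≡ (a' * + k) %ℕ b
    residues≡ k = %ℕ-≡ (a * + k) (a' * + k) b (s * + k)
      (trans (cong (_* + k) a≡) (lem a' s (+ b) (+ k)))

  -- Multiplication by the inverse `x` sends a zero residue to zero, yet it must return `k > 0`.
  residue≢0 : ∀ a b .{{_ : NonZero b}} → Bézout a (+ b) → ∀ k → 0 ℕ.< k → k ℕ.< b → (a * + k) %ℕ b ≢ 0
  residue≢0 a b@(suc _) (x , y , ax+by≡1) k 0<k k<b r≡0 = ℕ.<⇒≢ 0<k (begin
    0 ≡⟨ cong (_%ℕ b) (ℤ.*-zeroʳ x) ⟨
    (x * 0ℤ) %ℕ b ≡⟨ cong (λ z → (x * + z) %ℕ b) r≡0 ⟨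
    (x * + ((a * + k) %ℕ b)) %ℕ b ≡⟨ Bézout⇒inverse a x y b ax+by≡1 k k<b ⟩
    k ∎)
    where open ≡-Reasoning

  residue-neg : ∀ a b .{{_ : NonZero b}} → Bézout a (+ b) → ∀ k → 0 ℕ.< k → k ℕ.< b →
    residue (- a) b k ≡ + b - residue a b k
  residue-neg a b bez k 0<k k<b = trans (cong +_ (%ℕ-unique (- a * + k) b (b ℕ.∸ r) (- q - 1ℤ) b∸r<b (begin
      - a * + k                          ≡⟨ neg* a (+ k) ⟩
      - (a * + k)                        ≡⟨ cong -_ (ℤ.a≡a%ℕn+[a/ℕn]*n (a * + k) b) ⟩
      - (+ r + q * + b)                  ≡⟨ lem (+ r) q (+ b) ⟩
      + b - + r + (- q - 1ℤ) * + b       ≡⟨ cong (_+ (- q - 1ℤ) * + b) b-r ⟨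
      + (b ℕ.∸ r) + (- q - 1ℤ) * + b     ∎))) b-r
    where
    open ≡-Reasoning
    r = (a * + k) %ℕ b
    q = (a * + k) /ℕ b
    neg* : ∀ a k → - a * k ≡ - (a * k)
    neg* = solve-∀
    lem : ∀ r q b → - (r + q * b) ≡ b - r + (- q - 1ℤ) * b
    lem = solve-∀
    r≤b : r ℕ.≤ b
    r≤b = ℕ.<⇒≤ (ℤ.n%ℕd<d (a * + k) b)
    b-r : + (b ℕ.∸ r) ≡ + b - + r
    b-r = trans (sym (ℤ.⊖-≥ r≤b)) (sym (ℤ.m-n≡m⊖n b r))
    -- Only a nonzero `r` makes `b - r` a reduced remainder.
    b∸r<b : b ℕ.∸ r ℕ.< b
    b∸r<b = ℕ.∸-monoʳ-< (ℕ.n≢0⇒n>0 (residue≢0 a b bez k 0<k k<b)) r≤b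

  -- Replacing `r` by `b - r` changes the sign of `2 r - b`, hence of every term.
  V-neg : ∀ a b .{{_ : NonZero b}} → Bézout a (+ b) → V (- a) b ≡ - V a b
  V-neg a b@(suc b-1) bez = begin
    V (- a) b
      ≡⟨ ⅀-cong b-1 (λ k k<b-1 → trans
           (cong (λ z → (+ 2 * + suc k - + b) * (+ 2 * z - + b)) (residue-neg a b bez (suc k) (ℕ.s≤s ℕ.z≤n) (ℕ.s≤s k<b-1)))
           (lem (+ suc k) (+ b) (residue a b (suc k)))) ⟩
    ⅀ b-1 (λ k → - 1ℤ * V-term a b (suc k)) ≡⟨ *-distribˡ-⅀ b-1 (- 1ℤ) (V-term a b ∘ suc) ⟨
    - 1ℤ * V a b ≡⟨ ℤ.-1*i≡-i (V a b) ⟩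
    - V a b ∎
    where
    open ≡-Reasoning
    lem : ∀ k b r → (+ 2 * k - b) * (+ 2 * (b - r) - b) ≡ - 1ℤ * ((+ 2 * k - b) * (+ 2 * r - b))
    lem = solve-∀

open IntegerReciprocity
open import Data.Rational using (_+_; _*_; _-_; -_)
open import Tactic.RingSolver using (solve-∀)

-- Passage from integers to rationals.

ℚ-ring : ACR.AlmostCommutativeRing 0ℓ 0ℓ
ℚ-ring = ACR.fromCommutativeRing ℚ.+-*-commutativeRing (λ x → dec⇒maybe (0ℚ ℚ.≟ x))

-- `_/_` cancels a gcd and does not compute on open terms. Its properties are therefore proved for
-- unnormalised fractions, where equality is cross-multiplication.
toℚᵘ-divℕ : ∀ a n → toℚᵘ (divℕ a (suc n)) ℚᵘ.≃ mkℚᵘ a n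
toℚᵘ-divℕ a n = ℚ.toℚᵘ-fromℚᵘ (mkℚᵘ a n)

toℚ-+ : ∀ x y → toℚ (x ℤ.+ y) ≡ toℚ x + toℚ y
toℚ-+ x y = ℚ.toℚᵘ-injective (begin
  toℚᵘ (toℚ (x ℤ.+ y))                 ≈⟨ toℚᵘ-divℕ (x ℤ.+ y) 0 ⟩
  mkℚᵘ (x ℤ.+ y) 0                     ≈⟨ *≡* (lem x y) ⟩
  mkℚᵘ x 0 ℚᵘ.+ mkℚᵘ y 0               ≈⟨ ℚᵘ.+-cong (toℚᵘ-divℕ x 0) (toℚᵘ-divℕ y 0) ⟨
  toℚᵘ (toℚ x) ℚᵘ.+ toℚᵘ (toℚ y)       ≈⟨ ℚ.toℚᵘ-homo-+ (toℚ x) (toℚ y) ⟨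
  toℚᵘ (toℚ x + toℚ y)                 ∎)
  where
  open ℚᵘ.≃-Reasoning
  lem : ∀ x y → (x ℤ.+ y) ℤ.* + 1 ≡ (x ℤ.* + 1 ℤ.+ y ℤ.* + 1) ℤ.* + 1
  lem = ℤ-Solver.solve-∀

toℚ-* : ∀ x y → toℚ (x ℤ.* y) ≡ toℚ x * toℚ y
toℚ-* x y = ℚ.toℚᵘ-injective (begin
  toℚᵘ (toℚ (x ℤ.* y))                 ≈⟨ toℚᵘ-divℕ (x ℤ.* y) 0 ⟩
  mkℚᵘ x 0 ℚᵘ.* mkℚᵘ y 0               ≈⟨ ℚᵘ.*-cong (toℚᵘ-divℕ x 0) (toℚᵘ-divℕ y 0) ⟨
  toℚᵘ (toℚ x) ℚᵘ.* toℚᵘ (toℚ y)       ≈⟨ ℚ.toℚᵘ-homo-* (toℚ x) (toℚ y) ⟨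
  toℚᵘ (toℚ x * toℚ y)                 ∎)
  where open ℚᵘ.≃-Reasoning

toℚ-neg : ∀ x → toℚ (ℤ.- x) ≡ - toℚ x
toℚ-neg x = begin
  toℚ (ℤ.- x)                       ≡⟨ lem (toℚ (ℤ.- x)) (toℚ x) ⟩
  toℚ (ℤ.- x) + toℚ x + - toℚ x     ≡⟨ cong (_+ - toℚ x) (toℚ-+ (ℤ.- x) x) ⟨
  toℚ (ℤ.- x ℤ.+ x) + - toℚ x       ≡⟨ cong (λ z → toℚ z + - toℚ x) (ℤ.+-inverseˡ x) ⟩
  0ℚ + - toℚ x                      ≡⟨ ℚ.+-identityˡ (- toℚ x) ⟩
  - toℚ x                           ∎
  where
  open ≡-Reasoning
  lem : ∀ u v → u ≡ u + v + - v
  lem = solve-∀ ℚ-ring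

toℚ-minus : ∀ x y → toℚ (x ℤ.- y) ≡ toℚ x - toℚ y
toℚ-minus x y = trans (toℚ-+ x (ℤ.- y)) (cong (λ z → toℚ x + z) (toℚ-neg y))

toℚ-mono-< : ∀ {x y} → x ℤ.< y → toℚ x ℚ.< toℚ y
toℚ-mono-< {x} {y} x<y = ℚ.toℚᵘ-cancel-< (begin-strict
  toℚᵘ (toℚ x) ≃⟨ toℚᵘ-divℕ x 0 ⟩
  mkℚᵘ x 0     <⟨ ℚᵘ.*<* (subst₂ ℤ._<_ (sym (ℤ.*-identityʳ x)) (sym (ℤ.*-identityʳ y)) x<y) ⟩
  mkℚᵘ y 0     ≃⟨ toℚᵘ-divℕ y 0 ⟨
  toℚᵘ (toℚ y) ∎)
  where open ℚᵘ.≤-Reasoning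

toℚ-mono-≤ : ∀ {x y} → x ℤ.≤ y → toℚ x ℚ.≤ toℚ y
toℚ-mono-≤ {x} {y} x≤y with x ℤ.≟ y
... | yes x≡y = ℚ.≤-reflexive (cong toℚ x≡y)
... | no x≢y = ℚ.<⇒≤ (toℚ-mono-< (ℤ.≤∧≢⇒< x≤y x≢y))

toℚ-cancel-< : ∀ {x y} → toℚ x ℚ.< toℚ y → x ℤ.< y
toℚ-cancel-< {x} {y} x<y = ℤ.≰⇒> λ y≤x → ℚ.<-irrefl refl (ℚ.<-≤-trans x<y (toℚ-mono-≤ y≤x))

toℚ-injective : ∀ {x y} → toℚ x ≡ toℚ y → x ≡ y
toℚ-injective {x} {y} eq = ℤ.≤-antisym
  (ℤ.≮⇒≥ λ y<x → ℚ.<⇒≢ (toℚ-mono-< y<x) (sym eq))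
  (ℤ.≮⇒≥ λ x<y → ℚ.<⇒≢ (toℚ-mono-< x<y) eq)

divℕ-*-cancel : ∀ a b .{{_ : NonZero b}} → divℕ a b * toℚ (+ b) ≡ toℚ a
divℕ-*-cancel a b@(suc n) = ℚ.toℚᵘ-injective (begin
  toℚᵘ (divℕ a b * toℚ (+ b))              ≈⟨ ℚ.toℚᵘ-homo-* (divℕ a b) (toℚ (+ b)) ⟩
  toℚᵘ (divℕ a b) ℚᵘ.* toℚᵘ (toℚ (+ b))    ≈⟨ ℚᵘ.*-cong (toℚᵘ-divℕ a n) (toℚᵘ-divℕ (+ b) 0) ⟩
  mkℚᵘ a n ℚᵘ.* mkℚᵘ (+ b) 0               ≈⟨ *≡* (trans (ℤ.*-identityʳ (a ℤ.* + b)) (cong (λ z → a ℤ.* + z) (sym (ℕ.*-identityʳ b)))) ⟩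
  mkℚᵘ a 0                                 ≈⟨ toℚᵘ-divℕ a 0 ⟨
  toℚᵘ (toℚ a)                             ∎)
  where open ℚᵘ.≃-Reasoning

-- Floors, residues and reciprocals of fractions.

/ℕ-≤ : ∀ a b c d .{{_ : NonZero b}} .{{_ : NonZero d}} → a ℤ.* + d ≡ c ℤ.* + b → a ℤ./ℕ b ℤ.≤ c ℤ./ℕ d
/ℕ-≤ a b@(suc _) c d@(suc _) ad≡cb = subst (q ℤ.≤_) (ℤ.pred-suc q')
  (ℤ.i<j⇒i≤pred[j] {q} {ℤ.suc q'} (ℤ.*-cancelʳ-<-nonNeg {q} {ℤ.suc q'} (+ b)
    (ℤ.*-cancelʳ-<-nonNeg {q ℤ.* + b} {ℤ.suc q' ℤ.* + b} (+ d) (begin-strict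
      q ℤ.* + b ℤ.* + d           ≤⟨ ℤ.*-monoʳ-≤-nonNeg (+ d) (ℤ.[n/ℕd]*d≤n a b) ⟩
      a ℤ.* + d                   ≡⟨ ad≡cb ⟩
      c ℤ.* + b                   <⟨ ℤ.*-monoʳ-<-pos (+ b) (ℤ.n<s[n/ℕd]*d c d) ⟩
      ℤ.suc q' ℤ.* + d ℤ.* + b    ≡⟨ swap (ℤ.suc q') (+ d) (+ b) ⟩
      ℤ.suc q' ℤ.* + b ℤ.* + d    ∎))))
  where
  open ℤ.≤-Reasoning
  q = a ℤ./ℕ b
  q' = c ℤ./ℕ d
  swap : ∀ x y z → x ℤ.* y ℤ.* z ≡ x ℤ.* z ℤ.* y
  swap = ℤ-Solver.solve-∀

-- `floor` divides the reduced numerator and denominator, whereas `a` over `suc n` need not be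
-- reduced; `/ℕ-≤` in both directions shows that the quotients agree.
floor-≃ : ∀ p a n → toℚᵘ p ℚᵘ.≃ mkℚᵘ a n → floor p ≡ a ℤ./ℕ suc n
floor-≃ (ℚ.mkℚ u d _) a n (*≡* ub≡ad) = trans (ℤ.div-pos-is-/ℕ u (suc d))
  (ℤ.≤-antisym (/ℕ-≤ u (suc d) a (suc n) ub≡ad) (/ℕ-≤ a (suc n) u (suc d) (sym ub≡ad)))

floor-divℕ : ∀ a b .{{_ : NonZero b}} → floor (divℕ a b) ≡ a ℤ./ℕ b
floor-divℕ a (suc n) = floor-≃ (divℕ a (suc n)) a n (toℚᵘ-divℕ a n)

divℕ-% : ∀ a b .{{_ : NonZero b}} →
  (divℕ a b - toℚ (floor (divℕ a b))) * toℚ (+ b) ≡ toℚ (+ (a ℤ.%ℕ b))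
divℕ-% a b = begin
  (divℕ a b - toℚ (floor (divℕ a b))) * toℚ (+ b)
    ≡⟨ cong (λ z → (divℕ a b - toℚ z) * toℚ (+ b)) (floor-divℕ a b) ⟩
  (divℕ a b - toℚ q) * toℚ (+ b)
    ≡⟨ distrib (divℕ a b) (toℚ q) (toℚ (+ b)) ⟩
  divℕ a b * toℚ (+ b) - toℚ q * toℚ (+ b)
    ≡⟨ cong₂ _-_ (divℕ-*-cancel a b) (sym (toℚ-* q (+ b))) ⟩
  toℚ a - toℚ (q ℤ.* + b)
    ≡⟨ toℚ-minus a (q ℤ.* + b) ⟨
  toℚ (a ℤ.- q ℤ.* + b)
    ≡⟨ cong (λ z → toℚ (z ℤ.- q ℤ.* + b)) (ℤ.a≡a%ℕn+[a/ℕn]*n a b) ⟩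
  toℚ (+ (a ℤ.%ℕ b) ℤ.+ q ℤ.* + b ℤ.- q ℤ.* + b)
    ≡⟨ cong toℚ (cancel (+ (a ℤ.%ℕ b)) (q ℤ.* + b)) ⟩
  toℚ (+ (a ℤ.%ℕ b)) ∎
  where
  open ≡-Reasoning
  q = a ℤ./ℕ b
  distrib : ∀ x y z → (x - y) * z ≡ x * z - y * z
  distrib = solve-∀ ℚ-ring
  cancel : ∀ x y → x ℤ.+ y ℤ.- y ≡ x
  cancel = ℤ-Solver.solve-∀

-- Division is written as multiplication by `recip`, so that the ring solver can treat it as a
-- variable tied to `b` by `recip-inverse` alone.
recip : ℕ → ℚ
recip = divℕ (+ 1)

recip-inverse : ∀ b .{{_ : NonZero b}} → toℚ (+ b) * recip b ≡ 1ℚ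
recip-inverse b = trans (ℚ.*-comm (toℚ (+ b)) (recip b)) (divℕ-*-cancel (+ 1) b)

*-cancel-toℚ : ∀ b .{{_ : NonZero b}} x y → x * toℚ (+ b) ≡ y * toℚ (+ b) → x ≡ y
*-cancel-toℚ b x y xb≡yb = begin
  x                           ≡⟨ expand x ⟩
  x * toℚ (+ b) * recip b     ≡⟨ cong (_* recip b) xb≡yb ⟩
  y * toℚ (+ b) * recip b     ≡⟨ expand y ⟨
  y                           ∎
  where
  open ≡-Reasoning
  expand : ∀ x → x ≡ x * toℚ (+ b) * recip b
  expand x = sym (trans (ℚ.*-assoc x (toℚ (+ b)) (recip b))
    (trans (cong (λ z → x * z) (recip-inverse b)) (ℚ.*-identityʳ x)))

divℕ≡*recip : ∀ a b .{{_ : NonZero b}} → divℕ a b ≡ toℚ a * recip b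
divℕ≡*recip a b = *-cancel-toℚ b (divℕ a b) (toℚ a * recip b) (begin
  divℕ a b * toℚ (+ b)             ≡⟨ divℕ-*-cancel a b ⟩
  toℚ a                            ≡⟨ ℚ.*-identityʳ (toℚ a) ⟨
  toℚ a * 1ℚ                       ≡⟨ cong (λ z → toℚ a * z) (divℕ-*-cancel (+ 1) b) ⟨
  toℚ a * (recip b * toℚ (+ b))    ≡⟨ ℚ.*-assoc (toℚ a) (recip b) (toℚ (+ b)) ⟨
  toℚ a * recip b * toℚ (+ b)      ∎)
  where open ≡-Reasoning

-- Sawtooth values and the rational Dedekind sum.

saw-divℕ-0 : ∀ a b .{{_ : NonZero b}} → a ℤ.%ℕ b ≡ 0 → saw (divℕ a b) ≡ 0ℚ
saw-divℕ-0 a b r≡0 with divℕ a b ℚ.≟ toℚ (floor (divℕ a b))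
... | yes _ = refl
... | no x≢⌊x⌋ = contradiction x≡⌊x⌋ x≢⌊x⌋
  where
  x = divℕ a b
  ⌊x⌋ = toℚ (floor x)
  lem : ∀ x y → x ≡ x - y + y
  lem = solve-∀ ℚ-ring
  x-⌊x⌋≡0 : x - ⌊x⌋ ≡ 0ℚ
  x-⌊x⌋≡0 = *-cancel-toℚ b (x - ⌊x⌋) 0ℚ (trans (divℕ-% a b)
    (trans (cong (toℚ ∘ +_) r≡0) (sym (ℚ.*-zeroˡ (toℚ (+ b))))))
  x≡⌊x⌋ : x ≡ ⌊x⌋
  x≡⌊x⌋ = trans (lem x ⌊x⌋) (trans (cong (_+ ⌊x⌋) x-⌊x⌋≡0) (ℚ.+-identityˡ ⌊x⌋))

saw-divℕ : ∀ a b .{{_ : NonZero b}} → a ℤ.%ℕ b ≢ 0 →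
  toℚ (+ 2) * toℚ (+ b) * saw (divℕ a b) ≡ toℚ (+ 2 ℤ.* + (a ℤ.%ℕ b) ℤ.- + b)
saw-divℕ a b r≢0 with divℕ a b ℚ.≟ toℚ (floor (divℕ a b))
... | yes x≡⌊x⌋ = contradiction (ℤ.+-injective (toℚ-injective r≡0)) r≢0
  where
  open ≡-Reasoning
  x = divℕ a b
  r≡0 : toℚ (+ (a ℤ.%ℕ b)) ≡ toℚ (+ 0)
  r≡0 = begin
    toℚ (+ (a ℤ.%ℕ b))                        ≡⟨ divℕ-% a b ⟨
    (x - toℚ (floor x)) * toℚ (+ b)           ≡⟨ cong (λ z → (z - toℚ (floor x)) * toℚ (+ b)) x≡⌊x⌋ ⟩
    (toℚ (floor x) - toℚ (floor x)) * toℚ (+ b) ≡⟨ cong (_* toℚ (+ b)) (ℚ.+-inverseʳ (toℚ (floor x))) ⟩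
    0ℚ * toℚ (+ b)                            ≡⟨ ℚ.*-zeroˡ (toℚ (+ b)) ⟩
    0ℚ                                        ∎
... | no _ = begin
  toℚ (+ 2) * toℚ (+ b) * (x - toℚ (floor x) - ½)
    ≡⟨ lem (toℚ (+ b)) x (toℚ (floor x)) ⟩
  toℚ (+ 2) * ((x - toℚ (floor x)) * toℚ (+ b)) - toℚ (+ b)
    ≡⟨ cong (λ z → toℚ (+ 2) * z - toℚ (+ b)) (divℕ-% a b) ⟩
  toℚ (+ 2) * toℚ (+ (a ℤ.%ℕ b)) - toℚ (+ b)
    ≡⟨ cong (_- toℚ (+ b)) (toℚ-* (+ 2) (+ (a ℤ.%ℕ b))) ⟨
  toℚ (+ 2 ℤ.* + (a ℤ.%ℕ b)) - toℚ (+ b)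
    ≡⟨ toℚ-minus (+ 2 ℤ.* + (a ℤ.%ℕ b)) (+ b) ⟨
  toℚ (+ 2 ℤ.* + (a ℤ.%ℕ b) ℤ.- + b) ∎
  where
  open ≡-Reasoning
  x = divℕ a b
  lem : ∀ b x f → toℚ (+ 2) * b * (x - f - ½) ≡ toℚ (+ 2) * ((x - f) * b) - b
  lem = solve-∀ ℚ-ring

sumFrom1-toℚ : ∀ c f g n → (∀ k → k ℕ.< n → c * f (suc k) ≡ toℚ (g k)) →
  c * sumFrom1 n f ≡ toℚ (⅀ n g)
sumFrom1-toℚ c f g zero _ = ℚ.*-zeroʳ c
sumFrom1-toℚ c f g (suc n) cf≡g = begin
  c * (sumFrom1 n f + f (suc n))        ≡⟨ ℚ.*-distribˡ-+ c (sumFrom1 n f) (f (suc n)) ⟩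
  c * sumFrom1 n f + c * f (suc n)      ≡⟨ cong₂ _+_ (sumFrom1-toℚ c f g n (λ k k<n → cf≡g k (ℕ.m<n⇒m<1+n k<n))) (cf≡g n ℕ.≤-refl) ⟩
  toℚ (⅀ n g) + toℚ (g n)               ≡⟨ toℚ-+ (⅀ n g) (g n) ⟨
  toℚ (⅀ n g ℤ.+ g n)                   ≡⟨ cong toℚ (⅀-last n g) ⟨
  toℚ (⅀ (suc n) g)                     ∎
  where open ≡-Reasoning

dedekind≡V : ∀ a b .{{_ : NonZero b}} → Bézout a (+ b) →
  toℚ (+ 2) * toℚ (+ b) * (toℚ (+ 2) * toℚ (+ b)) * dedekind a b ≡ toℚ (V a b)
dedekind≡V a b@(suc b-1) bez = begin
  -- The last term vanishes because the sawtooth is zero at `b / b`. For smaller `k` coprimality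
  -- keeps both residues nonzero, so the zero branch of `saw` never occurs.
  c * c * (sumFrom1 b-1 f + f b)   ≡⟨ cong (λ z → c * c * (sumFrom1 b-1 f + z)) f[b]≡0 ⟩
  c * c * (sumFrom1 b-1 f + 0ℚ)    ≡⟨ cong (λ z → c * c * z) (ℚ.+-identityʳ (sumFrom1 b-1 f)) ⟩
  c * c * sumFrom1 b-1 f           ≡⟨ sumFrom1-toℚ (c * c) f (V-term a b ∘ suc) b-1 term ⟩
  toℚ (V a b)                      ∎
  where
  open ≡-Reasoning
  c = toℚ (+ 2) * toℚ (+ b)
  f : ℕ → ℚ
  f k = saw (divℕ (+ k) b) * saw (divℕ (a ℤ.* + k) b)
  f[b]≡0 : f b ≡ 0ℚ
  f[b]≡0 = trans (cong (_* saw (divℕ (a ℤ.* + b) b)) (saw-divℕ-0 (+ b) b (ℕ.n%n≡0 b)))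
    (ℚ.*-zeroˡ (saw (divℕ (a ℤ.* + b) b)))
  regroup : ∀ c x y → c * c * (x * y) ≡ c * x * (c * y)
  regroup = solve-∀ ℚ-ring
  term : ∀ k → k ℕ.< b-1 → c * c * f (suc k) ≡ toℚ (V-term a b (suc k))
  term k k<b-1 = begin
    c * c * f (suc k)
      ≡⟨ regroup c (saw (divℕ (+ suc k) b)) (saw (divℕ (a ℤ.* + suc k) b)) ⟩
    c * saw (divℕ (+ suc k) b) * (c * saw (divℕ (a ℤ.* + suc k) b))
      ≡⟨ cong₂ _*_ (saw-divℕ (+ suc k) b (λ eq → contradiction (trans (sym k%b≡k) eq) λ ()))
                   (saw-divℕ (a ℤ.* + suc k) b (residue≢0 a b bez (suc k) (ℕ.s≤s ℕ.z≤n) (ℕ.s≤s k<b-1))) ⟩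
    toℚ (+ 2 ℤ.* + (suc k ℕ.% b) ℤ.- + b) * toℚ (+ 2 ℤ.* residue a b (suc k) ℤ.- + b)
      ≡⟨ toℚ-* (+ 2 ℤ.* + (suc k ℕ.% b) ℤ.- + b) (+ 2 ℤ.* residue a b (suc k) ℤ.- + b) ⟨
    toℚ ((+ 2 ℤ.* + (suc k ℕ.% b) ℤ.- + b) ℤ.* (+ 2 ℤ.* residue a b (suc k) ℤ.- + b))
      ≡⟨ cong (λ z → toℚ ((+ 2 ℤ.* + z ℤ.- + b) ℤ.* (+ 2 ℤ.* residue a b (suc k) ℤ.- + b))) k%b≡k ⟩
    toℚ (V-term a b (suc k)) ∎
    where
    k%b≡k : suc k ℕ.% b ≡ suc k
    k%b≡k = ℕ.m<n⇒m%n≡m (ℕ.s≤s k<b-1)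

S≡V : ∀ a b .{{_ : NonZero b}} → Bézout a (+ b) →
  S a b ≡ toℚ (+ 3) * toℚ (V a b) * (recip b * recip b)
S≡V a b bez = begin
  toℚ (+ 12) * s
    ≡⟨ ℚ.*-identityʳ (toℚ (+ 12) * s) ⟨
  toℚ (+ 12) * s * (1ℚ * 1ℚ)
    ≡⟨ cong (λ z → toℚ (+ 12) * s * (z * z)) (recip-inverse b) ⟨
  toℚ (+ 12) * s * (B * recip b * (B * recip b))
    ≡⟨ regroup s B (recip b) ⟩
  toℚ (+ 3) * (toℚ (+ 2) * B * (toℚ (+ 2) * B) * s) * (recip b * recip b)
    ≡⟨ cong (λ z → toℚ (+ 3) * z * (recip b * recip b)) (dedekind≡V a b bez) ⟩
  toℚ (+ 3) * toℚ (V a b) * (recip b * recip b) ∎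
  where
  open ≡-Reasoning
  s = dedekind a b
  B = toℚ (+ b)
  regroup : ∀ s b i → toℚ (+ 12) * s * (b * i * (b * i)) ≡ toℚ (+ 3) * (toℚ (+ 2) * b * (toℚ (+ 2) * b) * s) * (i * i)
  regroup = solve-∀ ℚ-ring

-- Periodicity, oddness and reciprocity of `S`.

Bézout-shift : ∀ a b a' s → Bézout a b → a' ≡ a ℤ.+ s ℤ.* b → Bézout a' b
Bézout-shift a b a' s (x , y , ax+by≡1) a'≡ = x , y ℤ.- s ℤ.* x ,
  trans (cong (λ z → z ℤ.* x ℤ.+ b ℤ.* (y ℤ.- s ℤ.* x)) a'≡) (trans (lem a b s x y) ax+by≡1)
  where
  lem : ∀ a b s x y → (a ℤ.+ s ℤ.* b) ℤ.* x ℤ.+ b ℤ.* (y ℤ.- s ℤ.* x) ≡ a ℤ.* x ℤ.+ b ℤ.* y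
  lem = ℤ-Solver.solve-∀

Bézout-neg : ∀ a b → Bézout a b → Bézout (ℤ.- a) b
Bézout-neg a b (x , y , ax+by≡1) = ℤ.- x , y , trans (lem a b x y) ax+by≡1
  where
  lem : ∀ a b x y → ℤ.- a ℤ.* ℤ.- x ℤ.+ b ℤ.* y ≡ a ℤ.* x ℤ.+ b ℤ.* y
  lem = ℤ-Solver.solve-∀

S-periodic : ∀ a a' b .{{_ : NonZero b}} s → Bézout a (+ b) → a' ≡ a ℤ.+ s ℤ.* + b → S a' b ≡ S a b
S-periodic a a' b s bez a'≡ = begin
  S a' b                                               ≡⟨ S≡V a' b (Bézout-shift a (+ b) a' s bez a'≡) ⟩
  toℚ (+ 3) * toℚ (V a' b) * (recip b * recip b)       ≡⟨ cong (λ z → toℚ (+ 3) * toℚ z * (recip b * recip b)) (V-periodic a' a b s a'≡) ⟩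
  toℚ (+ 3) * toℚ (V a b) * (recip b * recip b)        ≡⟨ S≡V a b bez ⟨
  S a b                                                ∎
  where open ≡-Reasoning

S-neg : ∀ a b .{{_ : NonZero b}} → Bézout a (+ b) → S (ℤ.- a) b ≡ - S a b
S-neg a b bez = begin
  S (ℤ.- a) b                                          ≡⟨ S≡V (ℤ.- a) b (Bézout-neg a (+ b) bez) ⟩
  toℚ (+ 3) * toℚ (V (ℤ.- a) b) * ii                   ≡⟨ cong (λ z → toℚ (+ 3) * toℚ z * ii) (V-neg a b bez) ⟩
  toℚ (+ 3) * toℚ (ℤ.- V a b) * ii                     ≡⟨ cong (λ z → toℚ (+ 3) * z * ii) (toℚ-neg (V a b)) ⟩
  toℚ (+ 3) * (- toℚ (V a b)) * ii                     ≡⟨ lem (toℚ (V a b)) ii ⟩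
  - (toℚ (+ 3) * toℚ (V a b) * ii)                     ≡⟨ cong -_ (S≡V a b bez) ⟨
  - S a b                                              ∎
  where
  open ≡-Reasoning
  ii = recip b * recip b
  lem : ∀ v i → toℚ (+ 3) * (- v) * i ≡ - (toℚ (+ 3) * v * i)
  lem = solve-∀ ℚ-ring

-- This is `V-reciprocity` divided by a² b². Inserting the square of `A * iA` or of `B * iB`, both
-- equal to 1, brings the two sums to this common denominator.
S-reciprocity : ∀ a b .{{_ : NonZero a}} .{{_ : NonZero b}} → Bézout (+ a) (+ b) →
  S (+ a) b + S (+ b) a
  ≡ toℚ (+ a) * recip b + toℚ (+ b) * recip a + recip a * recip b - toℚ (+ 3)
S-reciprocity a b bez = begin
  S (+ a) b + S (+ b) a
    ≡⟨ cong₂ _+_ (S≡V (+ a) b bez) (S≡V (+ b) a (Bézout-comm {+ a} {+ b} bez)) ⟩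
  toℚ (+ 3) * v * (iB * iB) + toℚ (+ 3) * w * (iA * iA)
    ≡⟨ insert v w iA iB ⟩
  toℚ (+ 3) * v * (iB * iB) * (1ℚ * 1ℚ) + toℚ (+ 3) * w * (iA * iA) * (1ℚ * 1ℚ)
    ≡⟨ cong₂ (λ x y → toℚ (+ 3) * v * (iB * iB) * (x * x) + toℚ (+ 3) * w * (iA * iA) * (y * y)) (recip-inverse a) (recip-inverse b) ⟨
  toℚ (+ 3) * v * (iB * iB) * (A * iA * (A * iA)) + toℚ (+ 3) * w * (iA * iA) * (B * iB * (B * iB))
    ≡⟨ collect A B iA iB v w ⟩
  toℚ (+ 3) * (A * A * v + B * B * w) * (iA * iA * (iB * iB))
    ≡⟨ cong (_* (iA * iA * (iB * iB))) V-recip ⟩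
  A * B * (A * A + B * B + 1ℚ - toℚ (+ 3) * (A * B)) * (iA * iA * (iB * iB))
    ≡⟨ split A B iA iB ⟩
  rhs (A * iA) (B * iB)
    ≡⟨ cong₂ rhs (recip-inverse a) (recip-inverse b) ⟩
  rhs 1ℚ 1ℚ
    ≡⟨ tidy A B iA iB ⟩
  A * iB + B * iA + iA * iB - toℚ (+ 3) ∎
  where
  open ≡-Reasoning
  A = toℚ (+ a)
  B = toℚ (+ b)
  iA = recip a
  iB = recip b
  v = toℚ (V (+ a) b)
  w = toℚ (V (+ b) a)
  rhs : ℚ → ℚ → ℚ
  rhs x y = x * y * (x * (A * iB) + y * (B * iA) + iA * iB - toℚ (+ 3) * (x * y))
  insert : ∀ v w i j → toℚ (+ 3) * v * (j * j) + toℚ (+ 3) * w * (i * i)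
    ≡ toℚ (+ 3) * v * (j * j) * (1ℚ * 1ℚ) + toℚ (+ 3) * w * (i * i) * (1ℚ * 1ℚ)
  insert = solve-∀ ℚ-ring
  collect : ∀ A B i j v w →
    toℚ (+ 3) * v * (j * j) * (A * i * (A * i)) + toℚ (+ 3) * w * (i * i) * (B * j * (B * j))
    ≡ toℚ (+ 3) * (A * A * v + B * B * w) * (i * i * (j * j))
  collect = solve-∀ ℚ-ring
  split : ∀ A B i j → A * B * (A * A + B * B + 1ℚ - toℚ (+ 3) * (A * B)) * (i * i * (j * j))
    ≡ A * i * (B * j) * (A * i * (A * j) + B * j * (B * i) + i * j - toℚ (+ 3) * (A * i * (B * j)))
  split = solve-∀ ℚ-ring
  tidy : ∀ A B i j → 1ℚ * 1ℚ * (1ℚ * (A * j) + 1ℚ * (B * i) + i * j - toℚ (+ 3) * (1ℚ * 1ℚ))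
    ≡ A * j + B * i + i * j - toℚ (+ 3)
  tidy = solve-∀ ℚ-ring
  toℚ-sq-* : ∀ x y → toℚ (x ℤ.* x ℤ.* y) ≡ toℚ x * toℚ x * toℚ y
  toℚ-sq-* x y = trans (toℚ-* (x ℤ.* x) y) (cong (_* toℚ y) (toℚ-* x x))
  V-recip : toℚ (+ 3) * (A * A * v + B * B * w) ≡ A * B * (A * A + B * B + 1ℚ - toℚ (+ 3) * (A * B))
  V-recip = begin
    toℚ (+ 3) * (A * A * v + B * B * w)
      ≡⟨ cong (λ z → toℚ (+ 3) * z) (trans (toℚ-+ aaV bbV) (cong₂ _+_ (toℚ-sq-* (+ a) (V (+ a) b)) (toℚ-sq-* (+ b) (V (+ b) a)))) ⟨
    toℚ (+ 3) * toℚ (aaV ℤ.+ bbV)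
      ≡⟨ toℚ-* (+ 3) (aaV ℤ.+ bbV) ⟨
    toℚ (+ 3 ℤ.* (aaV ℤ.+ bbV))
      ≡⟨ cong toℚ (V-reciprocity a b bez) ⟩
    toℚ (ab ℤ.* (aa ℤ.+ bb ℤ.+ + 1 ℤ.- + 3 ℤ.* ab))
      ≡⟨ toℚ-* ab (aa ℤ.+ bb ℤ.+ + 1 ℤ.- + 3 ℤ.* ab) ⟩
    toℚ ab * toℚ (aa ℤ.+ bb ℤ.+ + 1 ℤ.- + 3 ℤ.* ab)
      ≡⟨ cong₂ _*_ (toℚ-* (+ a) (+ b)) (trans (toℚ-minus (aa ℤ.+ bb ℤ.+ + 1) (+ 3 ℤ.* ab)) (cong₂ _-_
           (trans (toℚ-+ (aa ℤ.+ bb) (+ 1)) (cong (_+ 1ℚ) (trans (toℚ-+ aa bb) (cong₂ _+_ (toℚ-* (+ a) (+ a)) (toℚ-* (+ b) (+ b))))))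
           (trans (toℚ-* (+ 3) ab) (cong (λ z → toℚ (+ 3) * z) (toℚ-* (+ a) (+ b)))))) ⟩
    A * B * (A * A + B * B + 1ℚ - toℚ (+ 3) * (A * B)) ∎
    where
    aaV = + a ℤ.* + a ℤ.* V (+ a) b
    bbV = + b ℤ.* + b ℤ.* V (+ b) a
    ab = + a ℤ.* + b
    aa = + a ℤ.* + a
    bb = + b ℤ.* + b

-- The three-term relation.

ℚ-drop-zero : ∀ c {x y} → x ≡ y → ∀ z → z + c * (x - y) ≡ z
ℚ-drop-zero c {x} {y} refl z = lem c x z
  where
  lem : ∀ c x z → z + c * (x - x) ≡ z
  lem = solve-∀ ℚ-ring

δ : ℕ → ℕ → ℕ → ℚ
δ b d q = toℚ (+ b) * (recip d * recip q) + toℚ (+ d) * (recip b * recip q) + toℚ (+ q) * (recip b * recip d)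

ρ : ℕ → ℕ → ℚ
ρ a b = toℚ (+ a) * recip b + toℚ (+ b) * recip a + recip a * recip b - toℚ (+ 3)

-- Dividing `ad - bc = q` in four ways gives `q/(bd) = a/b - c/d`, `q/(ac) = d/c - b/a`,
-- `1/(cd) = a/(cq) - b/(dq)` and `1/(ab) = d/(bq) - c/(aq)`; together these are the claim. In the
-- code, the determinant and five inverse relations enter as multiples to be dropped.
δ-flip : ∀ a b c d q .{{_ : NonZero a}} .{{_ : NonZero b}} .{{_ : NonZero c}} .{{_ : NonZero d}} .{{_ : NonZero q}} →
  + a ℤ.* + d ℤ.- + b ℤ.* + c ≡ + q → ρ a b - ρ c d + δ a c q ≡ δ b d q
δ-flip a b c d q det = begin
  ρ a b - ρ c d + δ a c q
    ≡⟨ identity A B C D Q iA iB iC iD iQ ⟩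
  z₆ ≡⟨ ℚ-drop-zero (C * iD - C * (iA * iQ)) (recip-inverse b) z₅ ⟩
  z₅ ≡⟨ ℚ-drop-zero (B * (iD * iQ) - B * iA) (recip-inverse c) z₄ ⟩
  z₄ ≡⟨ ℚ-drop-zero (- (A * iB) - A * (iC * iQ)) (recip-inverse d) z₃ ⟩
  z₃ ≡⟨ ℚ-drop-zero (iC * iD - iA * iB) (recip-inverse q) z₂ ⟩
  z₂ ≡⟨ ℚ-drop-zero (iA * iC + iA * iB * iQ - iB * iD - iC * iD * iQ) Q≡ z₁ ⟩
  z₁ ≡⟨ ℚ-drop-zero (D * iC + D * (iB * iQ)) (recip-inverse a) (δ b d q) ⟩
  δ b d q ∎
  where
  open ≡-Reasoning
  A = toℚ (+ a)
  B = toℚ (+ b)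
  C = toℚ (+ c)
  D = toℚ (+ d)
  Q = toℚ (+ q)
  iA = recip a
  iB = recip b
  iC = recip c
  iD = recip d
  iQ = recip q
  Q≡ : Q ≡ A * D - B * C
  Q≡ = trans (cong toℚ (sym det)) (trans (toℚ-minus (+ a ℤ.* + d) (+ b ℤ.* + c))
    (cong₂ _-_ (toℚ-* (+ a) (+ d)) (toℚ-* (+ b) (+ c))))
  z₁ = δ b d q + (D * iC + D * (iB * iQ)) * (A * iA - 1ℚ)
  z₂ = z₁ + (iA * iC + iA * iB * iQ - iB * iD - iC * iD * iQ) * (Q - (A * D - B * C))
  z₃ = z₂ + (iC * iD - iA * iB) * (Q * iQ - 1ℚ)
  z₄ = z₃ + (- (A * iB) - A * (iC * iQ)) * (D * iD - 1ℚ)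
  z₅ = z₄ + (B * (iD * iQ) - B * iA) * (C * iC - 1ℚ)
  z₆ = z₅ + (C * iD - C * (iA * iQ)) * (B * iB - 1ℚ)
  identity : ∀ A B C D Q iA iB iC iD iQ →
    A * iB + B * iA + iA * iB - toℚ (+ 3) - (C * iD + D * iC + iC * iD - toℚ (+ 3))
      + (A * (iC * iQ) + C * (iA * iQ) + Q * (iA * iC))
    ≡ B * (iD * iQ) + D * (iB * iQ) + Q * (iB * iD)
      + (D * iC + D * (iB * iQ)) * (A * iA - 1ℚ)
      + (iA * iC + iA * iB * iQ - iB * iD - iC * iD * iQ) * (Q - (A * D - B * C))
      + (iC * iD - iA * iB) * (Q * iQ - 1ℚ)
      + (- (A * iB) - A * (iC * iQ)) * (D * iD - 1ℚ)
      + (B * (iD * iQ) - B * iA) * (C * iC - 1ℚ)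
      + (C * iD - C * (iA * iQ)) * (B * iB - 1ℚ)
  identity = solve-∀ ℚ-ring

-- Reciprocity and oddness express `S(a , b)` by `S(- b , a)`, and likewise for `(c , d)`; the
-- rational errors combine by `δ-flip`. The variable `s` stands for `S(r , q)`, which the rotation
-- does not touch.
three-term-flip : ∀ a b c d q s .{{_ : NonZero a}} .{{_ : NonZero b}} .{{_ : NonZero c}} .{{_ : NonZero d}} .{{_ : NonZero q}} →
  Bézout (+ a) (+ b) → Bézout (+ c) (+ d) →
  + a ℤ.* + d ℤ.- + b ℤ.* + c ≡ + q →
  S (ℤ.- + b) a ≡ S (ℤ.- + d) c - s + δ a c q - toℚ (+ 3) →
  S (+ a) b ≡ S (+ c) d - s + δ b d q - toℚ (+ 3)
three-term-flip a b c d q s bezab bezcd det rec = begin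
  S (+ a) b
    ≡⟨ move (S (+ a) b) (S (+ b) a) ⟩
  S (+ a) b + S (+ b) a + - S (+ b) a
    ≡⟨ cong₂ _+_ (S-reciprocity a b bezab) (trans (sym (S-neg (+ b) a (Bézout-comm {+ a} {+ b} bezab))) rec) ⟩
  ρ a b + (S (ℤ.- + d) c - s + δ a c q - toℚ (+ 3))
    ≡⟨ cong (λ z → ρ a b + (z - s + δ a c q - toℚ (+ 3))) (S-neg (+ d) c (Bézout-comm {+ c} {+ d} bezcd)) ⟩
  ρ a b + (- S (+ d) c - s + δ a c q - toℚ (+ 3))
    ≡⟨ regroup (ρ a b) (S (+ c) d) (S (+ d) c) s (δ a c q) ⟩
  S (+ c) d - s + (ρ a b - (S (+ c) d + S (+ d) c) + δ a c q) - toℚ (+ 3)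
    ≡⟨ cong (λ z → S (+ c) d - s + (ρ a b - z + δ a c q) - toℚ (+ 3)) (S-reciprocity c d bezcd) ⟩
  S (+ c) d - s + (ρ a b - ρ c d + δ a c q) - toℚ (+ 3)
    ≡⟨ cong (λ z → S (+ c) d - s + z - toℚ (+ 3)) (δ-flip a b c d q det) ⟩
  S (+ c) d - s + δ b d q - toℚ (+ 3) ∎
  where
  open ≡-Reasoning
  move : ∀ x y → x ≡ x + y + - y
  move = solve-∀ ℚ-ring
  regroup : ∀ p x y s t → p + (- y - s + t - toℚ (+ 3)) ≡ x - s + (p - (x + y) + t) - toℚ (+ 3)
  regroup = solve-∀ ℚ-ring

-- For `(c , d) = (0 , 1)` the determinant forces `a = q`, and `b` is congruent to `r` modulo `q`.
-- As `S(0 , 1)` is zero, the relation is reciprocity for `q` and `b`.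
three-term-base : ∀ b q r v .{{_ : NonZero b}} .{{_ : NonZero q}} → Bézout (+ q) (+ b) →
  + b ≡ r ℤ.+ + q ℤ.* v →
  S (+ q) b ≡ S (+ 0) 1 - S r q + δ b 1 q - toℚ (+ 3)
three-term-base b q r v bez b≡ = begin
  S (+ q) b
    ≡⟨ move (S (+ q) b) (S (+ b) q) ⟩
  S (+ q) b + S (+ b) q - S (+ b) q
    ≡⟨ cong₂ _-_ (S-reciprocity q b bez) (sym (S-periodic (+ b) r q (ℤ.- v) (Bézout-comm {+ q} {+ b} bez) r≡)) ⟩
  ρ q b - S r q
    ≡⟨ regroup (toℚ (+ q)) (toℚ (+ b)) (recip q) (recip b) (S r q) ⟩
  S (+ 0) 1 - S r q + δ b 1 q - toℚ (+ 3) ∎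
  where
  open ≡-Reasoning
  move : ∀ x y → x ≡ x + y - y
  move = solve-∀ ℚ-ring
  regroup : ∀ Q B iQ iB s → Q * iB + B * iQ + iQ * iB - toℚ (+ 3) - s
    ≡ 0ℚ - s + (B * (1ℚ * iQ) + 1ℚ * (iB * iQ) + Q * (iB * 1ℚ)) - toℚ (+ 3)
  regroup = solve-∀ ℚ-ring
  lem : ∀ r q v → r ≡ r ℤ.+ q ℤ.* v ℤ.+ ℤ.- v ℤ.* q
  lem = ℤ-Solver.solve-∀
  r≡ : r ≡ + b ℤ.+ ℤ.- v ℤ.* + q
  r≡ = trans (lem r (+ q) v) (cong (ℤ._+ ℤ.- v ℤ.* + q) (sym b≡))

>0⇒+suc : ∀ {x} → + 0 ℤ.< x → ∃ λ n → x ≡ + suc n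
>0⇒+suc {+ suc n} _ = n , refl
>0⇒+suc {+ zero} (ℤ.+<+ ())
>0⇒+suc { -[1+ _ ]} ()

Bézout-0 : ∀ d → Bézout (+ 0) (+ d) → d ≡ 1
Bézout-0 d (x , y , eq) = ℕ.m*n≡1⇒m≡1 d ℤ.∣ y ∣ (begin
  d ℕ.* ℤ.∣ y ∣                         ≡⟨ ℤ.abs-* (+ d) y ⟨
  ℤ.∣ + d ℤ.* y ∣                       ≡⟨ cong ℤ.∣_∣ (trans (sym (ℤ.+-identityˡ (+ d ℤ.* y))) (cong (ℤ._+ + d ℤ.* y) (sym (ℤ.*-zeroˡ x)))) ⟩
  ℤ.∣ + 0 ℤ.* x ℤ.+ + d ℤ.* y ∣         ≡⟨ cong ℤ.∣_∣ eq ⟩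
  1                                     ∎)
  where open ≡-Reasoning

-- The relation is invariant under SL₂(ℤ) acting on (a , b) and (c , d) simultaneously;
-- the induction on d uses shears and the rotation (a , b) ↦ (− b , a).
ThreeTerm : ℕ → Set
ThreeTerm d = ∀ b q .{{_ : NonZero b}} .{{_ : NonZero d}} .{{_ : NonZero q}} a c r u v →
  Bézout a (+ b) → Bézout c (+ d) →
  a ℤ.* + d ℤ.- + b ℤ.* c ≡ + q →
  a ≡ r ℤ.* c ℤ.+ + q ℤ.* u → + b ≡ r ℤ.* + d ℤ.+ + q ℤ.* v →
  S a b ≡ S c d - S r q + δ b d q - toℚ (+ 3)

-- With `c < d`, either `c = 0`, and then coprimality gives `d = 1`, or the rotation makes `c` the
-- new second entry and the induction hypothesis applies.
three-term-reduced : ∀ d → (∀ {d'} → d' ℕ.< d → ThreeTerm d') →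
  ∀ b q .{{_ : NonZero b}} .{{_ : NonZero d}} .{{_ : NonZero q}} a c r u v → c ℕ.< d →
  Bézout a (+ b) → Bézout (+ c) (+ d) →
  a ℤ.* + d ℤ.- + b ℤ.* + c ≡ + q →
  a ≡ r ℤ.* + c ℤ.+ + q ℤ.* u → + b ≡ r ℤ.* + d ℤ.+ + q ℤ.* v →
  S a b ≡ S (+ c) d - S r q + δ b d q - toℚ (+ 3)
three-term-reduced d rec b q a zero r u v _ bez-ab bez-cd det _ b≡ with Bézout-0 d bez-cd
... | refl = subst (λ a → S a b ≡ S (+ 0) 1 - S r q + δ b 1 q - toℚ (+ 3)) (sym a≡q)
  (three-term-base b q r v (subst (λ a → Bézout a (+ b)) a≡q bez-ab)
    (trans b≡ (cong (ℤ._+ + q ℤ.* v) (ℤ.*-identityʳ r))))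
  where
  lem : ∀ a b → a ≡ a ℤ.* + 1 ℤ.- b ℤ.* + 0
  lem = ℤ-Solver.solve-∀
  a≡q : a ≡ + q
  a≡q = trans (lem a (+ b)) det
three-term-reduced d rec b q@(suc _) a c@(suc _) r u v c<d bez-ab bez-cd det a≡ b≡ with >0⇒+suc a>0
  where
  lem : ∀ a b c d → a ℤ.* d ℤ.- b ℤ.* c ℤ.+ b ℤ.* c ≡ a ℤ.* d
  lem = ℤ-Solver.solve-∀
  -- `a d = q + b c` is positive, so the rotated pair again has a positive second entry.
  a>0 : + 0 ℤ.< a
  a>0 = ℤ.*-cancelʳ-<-nonNeg {+ 0} {a} (+ d) (begin-strict
    + 0 ℤ.* + d                                     ≡⟨ ℤ.*-zeroˡ (+ d) ⟩
    + 0                                             <⟨ ℤ.+<+ (ℕ.s≤s ℕ.z≤n) ⟩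
    + (q ℕ.+ b ℕ.* c)                               ≡⟨ trans (ℤ.pos-+ q (b ℕ.* c)) (cong (λ z → + q ℤ.+ z) (ℤ.pos-* b c)) ⟩
    + q ℤ.+ + b ℤ.* + c                             ≡⟨ cong (ℤ._+ + b ℤ.* + c) det ⟨
    a ℤ.* + d ℤ.- + b ℤ.* + c ℤ.+ + b ℤ.* + c       ≡⟨ lem a (+ b) (+ c) (+ d) ⟩
    a ℤ.* + d                                       ∎)
    where open ℤ.≤-Reasoning
... | n , refl = three-term-flip a' b c d q (S r q) bez-ab bez-cd det
  (rec c<d a' q (ℤ.- + b) (ℤ.- + d) r (ℤ.- v) u
    (Bézout-neg (+ b) (+ a') (Bézout-comm {+ a'} {+ b} bez-ab))
    (Bézout-neg (+ d) (+ c) (Bézout-comm {+ c} {+ d} bez-cd))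
    (trans (rotate (+ a') (+ b) (+ c) (+ d)) det)
    (trans (cong ℤ.-_ b≡) (neg r (+ d) (+ q) v))
    a≡)
  where
  a' = suc n
  rotate : ∀ a b c d → ℤ.- b ℤ.* c ℤ.- a ℤ.* (ℤ.- d) ≡ a ℤ.* d ℤ.- b ℤ.* c
  rotate = ℤ-Solver.solve-∀
  neg : ∀ r d q v → ℤ.- (r ℤ.* d ℤ.+ q ℤ.* v) ≡ r ℤ.* (ℤ.- d) ℤ.+ q ℤ.* (ℤ.- v)
  neg = ℤ-Solver.solve-∀

-- The shear subtracts the quotient of `c` by `d` times `(b , d)` from `(a , c)`. It preserves the
-- determinant and `r`, changes `u` to `u - s v`, and leaves the sums fixed by periodicity.
three-term-step : ∀ d → (∀ {d'} → d' ℕ.< d → ThreeTerm d') → ThreeTerm d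
three-term-step d rec b q a c r u v bez-ab bez-cd det a≡ b≡ = begin
  S a b
    ≡⟨ S-periodic a a₀ b (ℤ.- s) bez-ab refl ⟨
  S a₀ b
    ≡⟨ three-term-reduced d rec b q a₀ c₀ r (u ℤ.- s ℤ.* v) v (ℤ.n%ℕd<d c d)
         (Bézout-shift a (+ b) a₀ (ℤ.- s) bez-ab refl)
         (Bézout-shift c (+ d) (+ c₀) (ℤ.- s) bez-cd c₀-shift)
         det₀ a₀≡ b≡ ⟩
  S (+ c₀) d - S r q + δ b d q - toℚ (+ 3)
    ≡⟨ cong (λ z → z - S r q + δ b d q - toℚ (+ 3)) (S-periodic c (+ c₀) d (ℤ.- s) bez-cd c₀-shift) ⟩
  S c d - S r q + δ b d q - toℚ (+ 3)   ∎
  where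
  open ≡-Reasoning
  s = c ℤ./ℕ d
  c₀ = c ℤ.%ℕ d
  a₀ = a ℤ.+ ℤ.- s ℤ.* + b
  c₀-shift : + c₀ ≡ c ℤ.+ ℤ.- s ℤ.* + d
  c₀-shift = trans (lem (+ c₀) s (+ d)) (cong (ℤ._+ ℤ.- s ℤ.* + d) (sym (ℤ.a≡a%ℕn+[a/ℕn]*n c d)))
    where
    lem : ∀ x s d → x ≡ x ℤ.+ s ℤ.* d ℤ.+ ℤ.- s ℤ.* d
    lem = ℤ-Solver.solve-∀
  det₀ : a₀ ℤ.* + d ℤ.- + b ℤ.* + c₀ ≡ + q
  det₀ = trans (cong (λ z → a₀ ℤ.* + d ℤ.- + b ℤ.* z) c₀-shift) (trans (lem a (+ b) c (+ d) s) det)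
    where
    lem : ∀ a b c d s → (a ℤ.+ ℤ.- s ℤ.* b) ℤ.* d ℤ.- b ℤ.* (c ℤ.+ ℤ.- s ℤ.* d) ≡ a ℤ.* d ℤ.- b ℤ.* c
    lem = ℤ-Solver.solve-∀
  a₀≡ : a₀ ≡ r ℤ.* + c₀ ℤ.+ + q ℤ.* (u ℤ.- s ℤ.* v)
  a₀≡ = trans (cong₂ (λ x y → x ℤ.+ ℤ.- s ℤ.* y) a≡ b≡)
    (trans (lem r c (+ d) (+ q) s u v) (cong (λ z → r ℤ.* z ℤ.+ + q ℤ.* (u ℤ.- s ℤ.* v)) (sym c₀-shift)))
    where
    lem : ∀ r c d q s u v → r ℤ.* c ℤ.+ q ℤ.* u ℤ.+ ℤ.- s ℤ.* (r ℤ.* d ℤ.+ q ℤ.* v)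
      ≡ r ℤ.* (c ℤ.+ ℤ.- s ℤ.* d) ℤ.+ q ℤ.* (u ℤ.- s ℤ.* v)
    lem = ℤ-Solver.solve-∀

three-term : ∀ d → ThreeTerm d
three-term = <-rec ThreeTerm three-term-step

-- The Dedekind sum at `(mt + 1 , nt)`.

Bézout-* : ∀ a b c → Bézout a b → Bézout a c → Bézout a (b ℤ.* c)
Bézout-* a b c (x , y , eq) (x' , y' , eq') =
  x ℤ.* (a ℤ.* x' ℤ.+ c ℤ.* y') ℤ.+ b ℤ.* y ℤ.* x' , y ℤ.* y' ,
  trans (lem a b c x y x' y') (cong₂ ℤ._*_ eq eq')
  where
  lem : ∀ a b c x y x' y' →
    a ℤ.* (x ℤ.* (a ℤ.* x' ℤ.+ c ℤ.* y') ℤ.+ b ℤ.* y ℤ.* x') ℤ.+ b ℤ.* c ℤ.* (y ℤ.* y')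
    ≡ (a ℤ.* x ℤ.+ b ℤ.* y) ℤ.* (a ℤ.* x' ℤ.+ c ℤ.* y')
  lem = ℤ-Solver.solve-∀

-- In the three-term relation for (mt + 1 , nt) and (m , n), r = m, so S(m , n) cancels.
S-neighbour : ∀ m n t u .{{_ : NonZero n}} .{{_ : NonZero t}} → Bézout m (+ n) →
  m ℤ.* + t ℤ.+ + 1 ≡ m ℤ.* m ℤ.+ + n ℤ.* u →
  S (m ℤ.* + t ℤ.+ + 1) (n ℕ.* t)
  ≡ toℚ (+ t) * recip n + toℚ (+ 2) * recip (n ℕ.* t) - toℚ (+ 3)
S-neighbour m n@(suc _) t@(suc _) u bez a≡ = begin
  S a b
    -- The determinant equals the second entry `n`, so `S(c , d)` and `S(r , q)` coincide as soon as
    -- `r = m`. The congruence for `nt` is immediate: `nt = m n + n (t - m)`.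
    ≡⟨ three-term n b n a m m u (+ t ℤ.- m) bez-ab bez det a≡ b≡ ⟩
  S m n - S m n + δ b n n - toℚ (+ 3)
    ≡⟨ cong (λ z → z - toℚ (+ 3)) (trans (cong (_+ δ b n n) (ℚ.+-inverseʳ (S m n))) (ℚ.+-identityˡ (δ b n n))) ⟩
  δ b n n - toℚ (+ 3)
    ≡⟨ cong (λ z → z * (iN * iN) + N * (iB * iN) + N * (iB * iN) - toℚ (+ 3)) (trans (cong toℚ (ℤ.pos-* n t)) (toℚ-* (+ n) (+ t))) ⟩
  N * T * (iN * iN) + N * (iB * iN) + N * (iB * iN) - toℚ (+ 3)
    ≡⟨ regroup N T iN iB ⟩
  T * iN * (N * iN) + toℚ (+ 2) * iB * (N * iN) - toℚ (+ 3)
    ≡⟨ cong (λ z → T * iN * z + toℚ (+ 2) * iB * z - toℚ (+ 3)) (recip-inverse n) ⟩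
  T * iN * 1ℚ + toℚ (+ 2) * iB * 1ℚ - toℚ (+ 3)
    ≡⟨ cong₂ (λ x y → x + y - toℚ (+ 3)) (ℚ.*-identityʳ (T * iN)) (ℚ.*-identityʳ (toℚ (+ 2) * iB)) ⟩
  T * iN + toℚ (+ 2) * iB - toℚ (+ 3) ∎
  where
  open ≡-Reasoning
  b = n ℕ.* t
  a = m ℤ.* + t ℤ.+ + 1
  N = toℚ (+ n)
  T = toℚ (+ t)
  iN = recip n
  iB = recip b
  regroup : ∀ N T i j → N * T * (i * i) + N * (j * i) + N * (j * i) - toℚ (+ 3)
    ≡ T * i * (N * i) + toℚ (+ 2) * j * (N * i) - toℚ (+ 3)
  regroup = solve-∀ ℚ-ring
  -- Modulo `n` the number `a` is `m²`, a product of units; modulo `t` it is 1.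
  bez-n : Bézout a (+ n)
  bez-n = Bézout-shift (m ℤ.* m) (+ n) a u
    (Bézout-comm {+ n} {m ℤ.* m} (Bézout-* (+ n) m m (Bézout-comm {m} {+ n} bez) (Bézout-comm {m} {+ n} bez)))
    (trans a≡ (cong (λ z → m ℤ.* m ℤ.+ z) (ℤ.*-comm (+ n) u)))
  bez-t : Bézout a (+ t)
  bez-t = + 1 , ℤ.- m , lem m (+ t)
    where
    lem : ∀ m t → (m ℤ.* t ℤ.+ + 1) ℤ.* + 1 ℤ.+ t ℤ.* (ℤ.- m) ≡ + 1
    lem = ℤ-Solver.solve-∀
  bez-ab : Bézout a (+ b)
  bez-ab = subst (Bézout a) (sym (ℤ.pos-* n t)) (Bézout-* a (+ n) (+ t) bez-n bez-t)
  det : a ℤ.* + n ℤ.- + b ℤ.* m ≡ + n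
  det = trans (cong (λ z → a ℤ.* + n ℤ.- z ℤ.* m) (ℤ.pos-* n t)) (lem m (+ n) (+ t))
    where
    lem : ∀ m n t → (m ℤ.* t ℤ.+ + 1) ℤ.* n ℤ.- n ℤ.* t ℤ.* m ≡ n
    lem = ℤ-Solver.solve-∀
  b≡ : + b ≡ m ℤ.* + n ℤ.+ + n ℤ.* (+ t ℤ.- m)
  b≡ = trans (ℤ.pos-* n t) (lem m (+ n) (+ t))
    where
    lem : ∀ m n t → n ℤ.* t ≡ m ℤ.* n ℤ.+ n ℤ.* (t ℤ.- m)
    lem = ℤ-Solver.solve-∀

-- Since `(m² + 1) / n = 1 / k`, the term `t / n` is `2m / n + l - j / k`. Subtracting the main term
-- leaves `2m / n + 2 / (nt)`, and multiplication by `nt` makes it an integer.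
E-value : ∀ j k l n t m w .{{_ : NonZero k}} .{{_ : NonZero n}} .{{_ : NonZero t}} →
  + n ≡ + k ℤ.* (m ℤ.* m ℤ.+ + 1) →
  + t ≡ + 2 ℤ.* m ℤ.+ + l ℤ.* + n ℤ.- + j ℤ.* (m ℤ.* m ℤ.+ + 1) →
  m ℤ.* + j ℤ.- + 1 ≡ w ℤ.* + k →
  (S (m ℤ.* + t ℤ.+ + 1) (n ℕ.* t) - (toℚ (+ l) - toℚ (+ 3) - divℕ (+ j) k)) * toℚ (+ (n ℕ.* t))
  ≡ toℚ (+ 2 ℤ.* (m ℤ.* + t ℤ.+ + 1))
E-value j k@(suc _) l n@(suc _) t@(suc _) m w n≡ t≡ mj-1≡ = begin
  (S (m ℤ.* + t ℤ.+ + 1) b - (L - toℚ (+ 3) - divℕ (+ j) k)) * B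
    ≡⟨ cong₂ (λ x y → (x - (L - toℚ (+ 3) - y)) * B) (S-neighbour m n t (m ℤ.* + l ℤ.- w) bez mt+1≡) (divℕ≡*recip (+ j) k) ⟩
  (T * iN + toℚ (+ 2) * iB - toℚ (+ 3) - (L - toℚ (+ 3) - J * iK)) * B
    ≡⟨ distrib T iN iB L J iK B ⟩
  (T * iN - L + J * iK) * B + toℚ (+ 2) * (B * iB)
    ≡⟨ cong₂ (λ x y → (T * iN - L + J * iK) * x + toℚ (+ 2) * y) (trans (cong toℚ (ℤ.pos-* n t)) (toℚ-* (+ n) (+ t))) (recip-inverse b) ⟩
  (T * iN - L + J * iK) * (N * T) + toℚ (+ 2) * 1ℚ
    ≡⟨ split T iN L J iK N ⟩
  (T * (N * iN) - L * N + J * (N * iK)) * T + toℚ (+ 2)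
    ≡⟨ cong₂ (λ x y → (T * x - L * N + J * y) * T + toℚ (+ 2)) (recip-inverse n) N*iK≡ ⟩
  (T * 1ℚ - L * N + J * X) * T + toℚ (+ 2)
    ≡⟨ cong (λ z → (z * 1ℚ - L * N + J * X) * T + toℚ (+ 2)) T≡ ⟩
  ((toℚ (+ 2) * M + L * N - J * X) * 1ℚ - L * N + J * X) * T + toℚ (+ 2)
    ≡⟨ tidy M L N J X T ⟩
  toℚ (+ 2) * (M * T + 1ℚ)
    ≡⟨ trans (toℚ-* (+ 2) (m ℤ.* + t ℤ.+ + 1)) (cong (λ z → toℚ (+ 2) * z) (trans (toℚ-+ (m ℤ.* + t) (+ 1)) (cong (_+ 1ℚ) (toℚ-* m (+ t))))) ⟨
  toℚ (+ 2 ℤ.* (m ℤ.* + t ℤ.+ + 1)) ∎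
  where
  open ≡-Reasoning
  b = n ℕ.* t
  x = m ℤ.* m ℤ.+ + 1
  B = toℚ (+ b)
  N = toℚ (+ n)
  T = toℚ (+ t)
  L = toℚ (+ l)
  J = toℚ (+ j)
  M = toℚ m
  X = toℚ x
  iN = recip n
  iB = recip b
  iK = recip k
  distrib : ∀ T iN iB L J iK B → (T * iN + toℚ (+ 2) * iB - toℚ (+ 3) - (L - toℚ (+ 3) - J * iK)) * B
    ≡ (T * iN - L + J * iK) * B + toℚ (+ 2) * (B * iB)
  distrib = solve-∀ ℚ-ring
  split : ∀ T iN L J iK N → (T * iN - L + J * iK) * (N * T) + toℚ (+ 2) * 1ℚ
    ≡ (T * (N * iN) - L * N + J * (N * iK)) * T + toℚ (+ 2)
  split = solve-∀ ℚ-ring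
  tidy : ∀ M L N J X T → ((toℚ (+ 2) * M + L * N - J * X) * 1ℚ - L * N + J * X) * T + toℚ (+ 2)
    ≡ toℚ (+ 2) * (M * T + 1ℚ)
  tidy = solve-∀ ℚ-ring
  N*iK≡ : N * iK ≡ X
  N*iK≡ = begin
    N * iK                        ≡⟨ cong (_* iK) (trans (cong toℚ n≡) (toℚ-* (+ k) x)) ⟩
    toℚ (+ k) * X * iK            ≡⟨ rotate (toℚ (+ k)) X iK ⟩
    X * (toℚ (+ k) * iK)          ≡⟨ cong (λ z → X * z) (recip-inverse k) ⟩
    X * 1ℚ                        ≡⟨ ℚ.*-identityʳ X ⟩
    X                             ∎
    where
    rotate : ∀ x y z → x * y * z ≡ y * (x * z)
    rotate = solve-∀ ℚ-ring
  T≡ : T ≡ toℚ (+ 2) * M + L * N - J * X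
  T≡ = trans (cong toℚ t≡) (trans (toℚ-minus (+ 2 ℤ.* m ℤ.+ + l ℤ.* + n) (+ j ℤ.* x)) (cong₂ _-_
    (trans (toℚ-+ (+ 2 ℤ.* m) (+ l ℤ.* + n)) (cong₂ _+_ (toℚ-* (+ 2) m) (toℚ-* (+ l) (+ n))))
    (toℚ-* (+ j) x)))
  -- `m j - w k = 1` treats the factor `k`, and `(m² + 1) - m m = 1` the factor `m² + 1`.
  bez : Bézout m (+ n)
  bez = subst (Bézout m) (sym n≡) (Bézout-* m (+ k) x
    (+ j , ℤ.- w , trans (lem m (+ j) (+ k) w) (trans (cong (λ z → z ℤ.+ + 1 ℤ.- w ℤ.* + k) mj-1≡) (lem' (w ℤ.* + k))))
    (ℤ.- m , + 1 , lem'' m))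
    where
    lem : ∀ m j k w → m ℤ.* j ℤ.+ k ℤ.* (ℤ.- w) ≡ m ℤ.* j ℤ.- + 1 ℤ.+ + 1 ℤ.- w ℤ.* k
    lem = ℤ-Solver.solve-∀
    lem' : ∀ y → y ℤ.+ + 1 ℤ.- y ≡ + 1
    lem' = ℤ-Solver.solve-∀
    lem'' : ∀ m → m ℤ.* (ℤ.- m) ℤ.+ (m ℤ.* m ℤ.+ + 1) ℤ.* + 1 ≡ + 1
    lem'' = ℤ-Solver.solve-∀
  -- The cofactor has two sources: `m l` comes from the summand `l n` of `t`, and `- w` from
  -- `(m² + 1) (1 - mj) = - w n`.
  mt+1≡ : m ℤ.* + t ℤ.+ + 1 ≡ m ℤ.* m ℤ.+ + n ℤ.* (m ℤ.* + l ℤ.- w)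
  mt+1≡ = begin
    m ℤ.* + t ℤ.+ + 1
      ≡⟨ cong (λ z → m ℤ.* z ℤ.+ + 1) t≡ ⟩
    m ℤ.* (+ 2 ℤ.* m ℤ.+ + l ℤ.* + n ℤ.- + j ℤ.* x) ℤ.+ + 1
      ≡⟨ cong (λ z → m ℤ.* (+ 2 ℤ.* m ℤ.+ + l ℤ.* z ℤ.- + j ℤ.* x) ℤ.+ + 1) n≡ ⟩
    m ℤ.* (+ 2 ℤ.* m ℤ.+ + l ℤ.* (+ k ℤ.* x) ℤ.- + j ℤ.* x) ℤ.+ + 1
      ≡⟨ lem m (+ j) (+ k) (+ l) w ⟩
    m ℤ.* m ℤ.+ + k ℤ.* x ℤ.* (m ℤ.* + l ℤ.- w) ℤ.+ (ℤ.- x) ℤ.* (m ℤ.* + j ℤ.- + 1 ℤ.- w ℤ.* + k)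
      ≡⟨ +-drop-zero (ℤ.- x) mj-1≡ (m ℤ.* m ℤ.+ + k ℤ.* x ℤ.* (m ℤ.* + l ℤ.- w)) ⟩
    m ℤ.* m ℤ.+ + k ℤ.* x ℤ.* (m ℤ.* + l ℤ.- w)
      ≡⟨ cong (λ z → m ℤ.* m ℤ.+ z ℤ.* (m ℤ.* + l ℤ.- w)) n≡ ⟨
    m ℤ.* m ℤ.+ + n ℤ.* (m ℤ.* + l ℤ.- w) ∎
    where
    lem : ∀ m j k l w → m ℤ.* (+ 2 ℤ.* m ℤ.+ l ℤ.* (k ℤ.* (m ℤ.* m ℤ.+ + 1)) ℤ.- j ℤ.* (m ℤ.* m ℤ.+ + 1)) ℤ.+ + 1
      ≡ m ℤ.* m ℤ.+ k ℤ.* (m ℤ.* m ℤ.+ + 1) ℤ.* (m ℤ.* l ℤ.- w) ℤ.+ (ℤ.- (m ℤ.* m ℤ.+ + 1)) ℤ.* (m ℤ.* j ℤ.- + 1 ℤ.- w ℤ.* k)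
    lem = ℤ-Solver.solve-∀

-- Bounds for `E`.

toℚ-nonNeg : ∀ n → ℚ.NonNegative (toℚ (+ n))
toℚ-nonNeg n = ℚ.nonNegative {toℚ (+ n)} (toℚ-mono-≤ {+ 0} {+ n} (ℤ.+≤+ ℕ.z≤n))

divPos-bound : ∀ ε (ε>0 : 0ℚ ℚ.< ε) x y → divPos x ε ε>0 + 1ℚ ℚ.≤ y → x ℚ.≤ (y - 1ℚ) * ε
divPos-bound ε ε>0 x y hyp = begin
  x                                   ≡⟨ ℚ.*-identityʳ x ⟨
  x * 1ℚ                              ≡⟨ cong (λ z → x * z) (ℚ.*-inverseˡ ε {{ε≢0}}) ⟨
  x * (ε⁻¹ * ε)                       ≡⟨ lem x ε⁻¹ ε ⟩
  (x * ε⁻¹ + 1ℚ - 1ℚ) * ε             ≤⟨ ℚ.*-monoʳ-≤-nonNeg ε {{ℚ.nonNegative (ℚ.<⇒≤ ε>0)}} (ℚ.+-monoˡ-≤ (- 1ℚ) hyp) ⟩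
  (y - 1ℚ) * ε                        ∎
  where
  open ℚ.≤-Reasoning
  ε≢0 : ℚ.NonZero ε
  ε≢0 = ℚ.>-nonZero ε>0
  ε⁻¹ : ℚ
  ε⁻¹ = ℚ.1/_ ε {{ε≢0}}
  lem : ∀ x i ε → x * (i * ε) ≡ (x * i + 1ℚ - 1ℚ) * ε
  lem = solve-∀ ℚ-ring

-- This is `(mt + 1) (m - 1) < (m² + 1) t` multiplied by `2 k`, which is `E (m - 1) < 2 / k` without
-- denominators.
E-bounds-ℕ : ∀ k M n t → + n ≡ + suc k ℤ.* (+ suc M ℤ.* + suc M ℤ.+ + 1) →
  + 2 ℤ.* (+ suc M ℤ.* + suc t ℤ.+ + 1) ℤ.* + M ℤ.* + suc k ℤ.< + 2 ℤ.* (+ n ℤ.* + suc t)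
E-bounds-ℕ k M n t n≡ = begin-strict
  p                                   ≡⟨ ℤ.+-identityʳ p ⟨
  p ℤ.+ + 0                           <⟨ ℤ.+-monoʳ-< p (ℤ.+<+ (ℕ.s≤s ℕ.z≤n)) ⟩
  -- Apart from the factor `2 k`, the slack is `t + m (t - 1) + 1`; with `suc t` for `t` and `suc M`
  -- for `m` it becomes `2 + (M + 2) t`, visibly positive.
  p ℤ.+ + (2 ℕ.* suc k ℕ.* (2 ℕ.+ (M ℕ.+ 2) ℕ.* t))
    ≡⟨ cong (λ z → p ℤ.+ z) (trans (ℤ.pos-* (2 ℕ.* suc k) (2 ℕ.+ (M ℕ.+ 2) ℕ.* t))
         (cong₂ ℤ._*_ (ℤ.pos-* 2 (suc k)) (trans (ℤ.pos-+ 2 ((M ℕ.+ 2) ℕ.* t)) (cong (λ z → + 2 ℤ.+ z) (ℤ.pos-* (M ℕ.+ 2) t))))) ⟩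
  p ℤ.+ + 2 ℤ.* + suc k ℤ.* (+ 2 ℤ.+ (+ M ℤ.+ + 2) ℤ.* + t)
    ≡⟨ lem (+ suc k) (+ M) (+ t) ⟩
  + 2 ℤ.* (+ suc k ℤ.* (+ suc M ℤ.* + suc M ℤ.+ + 1) ℤ.* + suc t)
    ≡⟨ cong (λ z → + 2 ℤ.* (z ℤ.* + suc t)) n≡ ⟨
  + 2 ℤ.* (+ n ℤ.* + suc t)           ∎
  where
  open ℤ.≤-Reasoning
  p = + 2 ℤ.* (+ suc M ℤ.* + suc t ℤ.+ + 1) ℤ.* + M ℤ.* + suc k
  lem : ∀ k M t → + 2 ℤ.* ((+ 1 ℤ.+ M) ℤ.* (+ 1 ℤ.+ t) ℤ.+ + 1) ℤ.* M ℤ.* k ℤ.+ + 2 ℤ.* k ℤ.* (+ 2 ℤ.+ (M ℤ.+ + 2) ℤ.* t)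
    ≡ + 2 ℤ.* (k ℤ.* ((+ 1 ℤ.+ M) ℤ.* (+ 1 ℤ.+ M) ℤ.+ + 1) ℤ.* (+ 1 ℤ.+ t))
  lem = ℤ-Solver.solve-∀

-- With `M = m - 1`, the estimate `e M < 2 / k ≤ M ε` yields the upper bound by cancelling `M`; this
-- is the source of the lower bound imposed on `m`.
E-bounds : ∀ ε k M n t e .{{_ : NonZero k}} .{{_ : NonZero t}} →
  + n ≡ + k ℤ.* (+ suc M ℤ.* + suc M ℤ.+ + 1) →
  divℕ (+ 2) k ℚ.≤ toℚ (+ M) * ε →
  e * toℚ (+ (n ℕ.* t)) ≡ toℚ (+ 2 ℤ.* (+ suc M ℤ.* + t ℤ.+ + 1)) →
  0ℚ ℚ.< e × e ℚ.< ε
E-bounds ε k@(suc k-1) M n t@(suc t-1) e n≡ bound eq = e>0 , e<ε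
  where
  open ℚ.≤-Reasoning
  b = n ℕ.* t
  B = toℚ (+ b)
  K = toℚ (+ k)
  M' = toℚ (+ M)
  y = + 2 ℤ.* (+ suc M ℤ.* + t ℤ.+ + 1)
  e>0 : 0ℚ ℚ.< e
  e>0 = ℚ.*-cancelʳ-<-nonNeg B {{toℚ-nonNeg b}} (begin-strict
    0ℚ * B    ≡⟨ ℚ.*-zeroˡ B ⟩
    0ℚ        <⟨ toℚ-mono-< {+ 0} {y} (ℤ.+<+ (ℕ.s≤s ℕ.z≤n)) ⟩
    toℚ y     ≡⟨ eq ⟨
    e * B     ∎)
  rotate : ∀ e m b k → e * m * b * k ≡ e * b * m * k
  rotate = solve-∀ ℚ-ring
  rotate' : ∀ d b k → d * k * b ≡ d * b * k
  rotate' = solve-∀ ℚ-ring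
  eM<2/k : e * M' ℚ.< divℕ (+ 2) k
  eM<2/k = ℚ.*-cancelʳ-<-nonNeg B {{toℚ-nonNeg b}} (ℚ.*-cancelʳ-<-nonNeg K {{toℚ-nonNeg k}} (begin-strict
    e * M' * B * K                ≡⟨ rotate e M' B K ⟩
    e * B * M' * K                ≡⟨ cong (λ z → z * M' * K) eq ⟩
    toℚ y * M' * K                ≡⟨ trans (toℚ-* (y ℤ.* + M) (+ k)) (cong (_* K) (toℚ-* y (+ M))) ⟨
    toℚ (y ℤ.* + M ℤ.* + k)       <⟨ toℚ-mono-< (E-bounds-ℕ k-1 M n t-1 n≡) ⟩
    toℚ (+ 2 ℤ.* (+ n ℤ.* + t))   ≡⟨ trans (toℚ-* (+ 2) (+ n ℤ.* + t)) (cong (λ z → toℚ (+ 2) * toℚ z) (sym (ℤ.pos-* n t))) ⟩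
    toℚ (+ 2) * B                 ≡⟨ cong (_* B) (divℕ-*-cancel (+ 2) k) ⟨
    divℕ (+ 2) k * K * B          ≡⟨ rotate' (divℕ (+ 2) k) B K ⟩
    divℕ (+ 2) k * B * K          ∎))
  e<ε : e ℚ.< ε
  e<ε = ℚ.*-cancelʳ-<-nonNeg M' {{toℚ-nonNeg M}} (begin-strict
    e * M'           <⟨ eM<2/k ⟩
    divℕ (+ 2) k     ≤⟨ bound ⟩
    M' * ε           ≡⟨ ℚ.*-comm M' ε ⟩
    ε * M'           ∎)

-- Positivity of `2 / k` forces `m - 1 > 0`, which allows the integer `m` to be replaced by some
-- `suc M`.
m>1 : ∀ ε → 0ℚ ℚ.< ε → ∀ k .{{_ : NonZero k}} m → divℕ (+ 2) k ℚ.≤ (toℚ m - 1ℚ) * ε → + 1 ℤ.< m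
m>1 ε ε>0 k m bound = toℚ-cancel-< (begin-strict
  1ℚ                  ≡⟨ ℚ.+-identityˡ 1ℚ ⟨
  0ℚ + 1ℚ             <⟨ ℚ.+-monoˡ-< 1ℚ m-1>0 ⟩
  toℚ m - 1ℚ + 1ℚ     ≡⟨ lem (toℚ m) ⟩
  toℚ m               ∎)
  where
  open ℚ.≤-Reasoning
  lem : ∀ x → x - 1ℚ + 1ℚ ≡ x
  lem = solve-∀ ℚ-ring
  2/k>0 : 0ℚ ℚ.< divℕ (+ 2) k
  2/k>0 = ℚ.*-cancelʳ-<-nonNeg (toℚ (+ k)) {{toℚ-nonNeg k}} (begin-strict
    0ℚ * toℚ (+ k)              ≡⟨ ℚ.*-zeroˡ (toℚ (+ k)) ⟩
    0ℚ                          <⟨ toℚ-mono-< {+ 0} {+ 2} (ℤ.+<+ (ℕ.s≤s ℕ.z≤n)) ⟩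
    toℚ (+ 2)                   ≡⟨ divℕ-*-cancel (+ 2) k ⟨
    divℕ (+ 2) k * toℚ (+ k)    ∎)
  m-1>0 : 0ℚ ℚ.< toℚ m - 1ℚ
  m-1>0 = ℚ.*-cancelʳ-<-nonNeg ε {{ℚ.nonNegative (ℚ.<⇒≤ ε>0)}} (begin-strict
    0ℚ * ε              ≡⟨ ℚ.*-zeroˡ ε ⟩
    0ℚ                  <⟨ 2/k>0 ⟩
    divℕ (+ 2) k        ≤⟨ bound ⟩
    (toℚ m - 1ℚ) * ε    ∎)

-- The theorem speaks of integers `n`, `t` and of the modulus `∣ n t ∣`. As variables equal to
-- `+ n'` and `+ t'` they can be eliminated by `refl`, leaving the natural product.
E-bounds-ℤ : ∀ ε j k l M w n' t' (n t : ℤ) .{{_ : NonZero k}} .{{_ : NonZero n'}} .{{_ : NonZero t'}} →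
  let m = + suc M
      E = S (m ℤ.* t ℤ.+ + 1) ℤ.∣ n ℤ.* t ∣ - (toℚ (+ l) - toℚ (+ 3) - divℕ (+ j) k)
  in n ≡ + n' → t ≡ + t' →
    + n' ≡ + k ℤ.* (m ℤ.* m ℤ.+ + 1) →
    + t' ≡ + 2 ℤ.* m ℤ.+ + l ℤ.* + n' ℤ.- + j ℤ.* (m ℤ.* m ℤ.+ + 1) →
    m ℤ.* + j ℤ.- + 1 ≡ w ℤ.* + k →
    divℕ (+ 2) k ℚ.≤ toℚ (+ M) * ε →
    0ℚ ℚ.< E × E ℚ.< ε
E-bounds-ℤ ε j k l M w n' t' .(+ n') .(+ t') refl refl n≡ t≡ mj-1≡ bound =
  subst (λ b → let E = S (+ suc M ℤ.* + t' ℤ.+ + 1) b - r in 0ℚ ℚ.< E × E ℚ.< ε) (sym (ℤ.abs-* (+ n') (+ t')))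
    (E-bounds ε k M n' t' (S (+ suc M ℤ.* + t' ℤ.+ + 1) (n' ℕ.* t') - r) n≡ bound
      (E-value j k l n' t' (+ suc M) w n≡ t≡ mj-1≡))
  where
  r = toℚ (+ l) - toℚ (+ 3) - divℕ (+ j) k

-- Positivity of `n` and `t`, and the conclusion.

n-ℕ : ∀ k m → + (k ℕ.* (m ℕ.* m ℕ.+ 1)) ≡ + k ℤ.* (+ m ℤ.* + m ℤ.+ + 1)
n-ℕ k m = trans (ℤ.pos-* k (m ℕ.* m ℕ.+ 1)) (cong (λ z → + k ℤ.* (z ℤ.+ + 1)) (ℤ.pos-* m m))

-- Substituting `n` gives `t = 2m + (l k - j) (m² + 1)`. As `j ≤ k ≤ l k`, the factor `p = l k - j`
-- is a natural number, so `t` is positive for positive `m`.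
t-ℕ : ∀ j k l m p → j ℕ.+ p ≡ l ℕ.* k → let x = + m ℤ.* + m ℤ.+ + 1 in
  + (2 ℕ.* m ℕ.+ p ℕ.* (m ℕ.* m ℕ.+ 1)) ≡ + 2 ℤ.* + m ℤ.+ + l ℤ.* (+ k ℤ.* x) ℤ.- + j ℤ.* x
t-ℕ j k l m p j+p≡lk = begin
  + (2 ℕ.* m ℕ.+ p ℕ.* (m ℕ.* m ℕ.+ 1))
    ≡⟨ trans (ℤ.pos-+ (2 ℕ.* m) (p ℕ.* (m ℕ.* m ℕ.+ 1))) (cong₂ ℤ._+_ (ℤ.pos-* 2 m) (n-ℕ p m)) ⟩
  + 2 ℤ.* + m ℤ.+ + p ℤ.* x
    ≡⟨ lem (+ m) (+ p) (+ j) x ⟩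
  + 2 ℤ.* + m ℤ.+ (+ j ℤ.+ + p) ℤ.* x ℤ.- + j ℤ.* x
    ≡⟨ cong (λ z → + 2 ℤ.* + m ℤ.+ z ℤ.* x ℤ.- + j ℤ.* x) (trans (sym (ℤ.pos-+ j p)) (trans (cong +_ j+p≡lk) (ℤ.pos-* l k))) ⟩
  + 2 ℤ.* + m ℤ.+ + l ℤ.* + k ℤ.* x ℤ.- + j ℤ.* x
    ≡⟨ cong (λ z → + 2 ℤ.* + m ℤ.+ z ℤ.- + j ℤ.* x) (ℤ.*-assoc (+ l) (+ k) x) ⟩
  + 2 ℤ.* + m ℤ.+ + l ℤ.* (+ k ℤ.* x) ℤ.- + j ℤ.* x ∎
  where
  open ≡-Reasoning
  x = + m ℤ.* + m ℤ.+ + 1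
  lem : ∀ m p j x → + 2 ℤ.* m ℤ.+ p ℤ.* x ≡ + 2 ℤ.* m ℤ.+ (j ℤ.+ p) ℤ.* x ℤ.- j ℤ.* x
  lem = ℤ-Solver.solve-∀

theorem1 : (ε : ℚ) (ε>0 : 0ℚ ℚ.< ε) (j k : ℕ) → 0 ℕ.< j → j ℕ.≤ k → Coprime j k →
    (m : ℤ) → divPos (divℕ (+ 2) k) ε ε>0 ℚ.+ 1ℚ ℚ.≤ toℚ m →
    (+ k) ∣ (m ℤ.* + j ℤ.- + 1) →
    (l : ℕ) → 0 ℕ.< l →
    let n = + k ℤ.* (m ℤ.* m ℤ.+ + 1)
        t = + 2 ℤ.* m ℤ.+ + l ℤ.* n ℤ.- + j ℤ.* (m ℤ.* m ℤ.+ + 1)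
        E = S (m ℤ.* t ℤ.+ + 1) ℤ.∣ n ℤ.* t ∣ ℚ.- (toℚ (+ l) ℚ.- toℚ (+ 3) ℚ.- divℕ (+ j) k)
    in 0ℚ ℚ.< E × E ℚ.< ε
theorem1 ε ε>0 (suc _) zero _ () _
theorem1 ε ε>0 j k@(suc _) 0<j j≤k _ m hyp k∣mj-1 l@(suc _) _ = main m (m>1 ε ε>0 k m bound) bound (Signed.∣ᵤ⇒∣ k∣mj-1)
  where
  bound : divℕ (+ 2) k ℚ.≤ (toℚ m - 1ℚ) * ε
  bound = divPos-bound ε ε>0 (divℕ (+ 2) k) (toℚ m) hyp
  p : ℕ
  p = l ℕ.* k ℕ.∸ j
  j+p≡lk : j ℕ.+ p ≡ l ℕ.* k
  j+p≡lk = ℕ.m+[n∸m]≡n (ℕ.≤-trans j≤k (ℕ.m≤n*m k l))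
  main : ∀ m → + 1 ℤ.< m → divℕ (+ 2) k ℚ.≤ (toℚ m - 1ℚ) * ε → (+ k) Signed.∣ (m ℤ.* + j ℤ.- + 1) →
    let n = + k ℤ.* (m ℤ.* m ℤ.+ + 1)
        t = + 2 ℤ.* m ℤ.+ + l ℤ.* n ℤ.- + j ℤ.* (m ℤ.* m ℤ.+ + 1)
        E = S (m ℤ.* t ℤ.+ + 1) ℤ.∣ n ℤ.* t ∣ - (toℚ (+ l) - toℚ (+ 3) - divℕ (+ j) k)
    in 0ℚ ℚ.< E × E ℚ.< ε
  main (+ zero) (ℤ.+<+ ()) _ _
  main m@(+ suc M) _ bound (Signed.divides w mj-1≡) =
    E-bounds-ℤ ε j k l M w n' t' n t (sym (n-ℕ k (suc M))) (sym (t-ℕ j k l (suc M) p j+p≡lk))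
      (n-ℕ k (suc M)) (trans (t-ℕ j k l (suc M) p j+p≡lk) (cong (λ z → + 2 ℤ.* m ℤ.+ + l ℤ.* z ℤ.- + j ℤ.* (m ℤ.* m ℤ.+ + 1)) (sym (n-ℕ k (suc M)))))
      mj-1≡ (subst (λ z → divℕ (+ 2) k ℚ.≤ z * ε) (sym (toℚ-minus m (+ 1))) bound)
    where
    n = + k ℤ.* (m ℤ.* m ℤ.+ + 1)
    t = + 2 ℤ.* m ℤ.+ + l ℤ.* n ℤ.- + j ℤ.* (m ℤ.* m ℤ.+ + 1)
    n' = k ℕ.* (suc M ℕ.* suc M ℕ.+ 1)
    t' = 2 ℕ.* suc M ℕ.+ p ℕ.* (suc M ℕ.* suc M ℕ.+ 1)
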